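{- For all integers $n\ge0$: \begin{align*} pl_2(2n+1)&\equiv pl_2(2n)\pmod 2,\\ pl_3(3n+2)&\equiv 0\pmod 3,\\ pl_3(3n+1)&\equiv pl_3(3n)\pmod 3,\\ pl_5(5n+2)&\equiv pl_5(5n+4)\pmod 5,\\ pl_5(5n+1)&\equiv pl_5(5n+3)\pmod 5,\\ pl_7(7n+2)+pl_7(7n+3)&\equiv pl_7(7n+4)+pl_7(7n+5)\pmod 7. \end{align*}
   Context: For a positive integer $k$, $pl_k(n)$ denotes the number of $k$-component plane partitions of $n$ (plane partitions of $n$ all of whose entries are $\le k$), with $pl_k(0)=1$ and $pl_k(n)=0$ for $n<0$; equivalently $\sum_{n\ge0}pl_k(n)q^n=\prod_{n=1}^{\infty}(1-q^n)^{ -\min(k,n)}$. -}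

module Defs where

open import Data.List.Base
  using (List; []; _∷_; length; map; filter; upTo; cartesianProductWith)
open import Data.List.Properties using (∷-injective)
open import Data.List.Membership.Propositional using (_∈_)
open import Data.List.Membership.Propositional.Properties
  using (∈-filter⁺; ∈-filter⁻; ∈-upTo⁺; ∈-cartesianProductWith⁺; ∈-cartesianProductWith⁻)
open import Data.List.Relation.Binary.Prefix.Heterogeneous using (Prefix)
open import Data.List.Relation.Binary.Prefix.Heterogeneous.Properties using (prefix?)
open import Data.List.Relation.Unary.All as All using (All; []; _∷_; all?)
open import Data.List.Relation.Unary.Any using (here; there)
open import Data.List.Relation.Unary.AllPairs using ([]; _∷_)
open import Data.List.Relation.Unary.Linked using (Linked; linked?)
open import Data.List.Relation.Unary.Unique.Propositional using (Unique)
open import Data.List.Relation.Unary.Unique.Propositional.Properties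
  using (filter⁺; upTo⁺; cartesianProductWith⁺)
open import Data.Nat.Base using (ℕ; zero; suc; _+_; _≤_; _<_; _≥_; z≤n; s≤s)
open import Data.Nat.ListAction using (sum)
open import Data.Nat.Properties
  using (_≟_; _≤?_; _<?_; _≥?_; ≤-trans; ≤-reflexive; +-mono-≤; m≤m+n; m≤n+m)
open import Data.Product.Base using (_×_; _,_; proj₂)
open import Function.Bundles using (_⇔_; mk⇔)
open import Relation.Binary.PropositionalEquality using (_≡_; refl; sym)
open import Relation.Nullary.Decidable using (map′; _×-dec_)
open import Relation.Unary using (Decidable)

-- An array is given by the list of its rows. Zeros are left out and no row is
-- empty, so that distinct lists are distinct arrays.
--
-- `Prefix _≤_ s r` says that the row s is no longer than r and that each of
-- its entries is at most the entry of r in the same column.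

record IsPlanePartition (k n : ℕ) (π : List (List ℕ)) : Set where
  field
    nonempty  : All (λ r → 0 < length r) π
    positive  : All (All (0 <_)) π
    bounded   : All (All (_≤ k)) π
    rows      : All (Linked _≥_) π
    columns   : Linked (λ r s → Prefix _≤_ s r) π
    size      : sum (map sum π) ≡ n

isPlanePartition? : ∀ k n → Decidable (IsPlanePartition k n)
isPlanePartition? k n π = map′
  (λ (a , b , c , d , e , f) → record
    { nonempty = a ; positive = b ; bounded = c ; rows = d ; columns = e ; size = f })
  (λ p → let open IsPlanePartition p in
    nonempty , positive , bounded , rows , columns , size)
  (      all? (λ r → 0 <? length r) π
   ×-dec all? (all? (0 <?_)) π
   ×-dec all? (all? (_≤? k)) π
   ×-dec all? (linked? _≥?_) π
   ×-dec linked? (λ r s → prefix? _≤?_ s r) π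
   ×-dec (sum (map sum π) ≟ n))

-- All lists of length at most m with elements from xs.
listsUpTo : ∀ {A : Set} → ℕ → List A → List (List A)
listsUpTo zero    xs = [] ∷ []
listsUpTo (suc m) xs = [] ∷ cartesianProductWith _∷_ xs (listsUpTo m xs)

-- A plane partition of n has at most n rows, each of length at most n.
planePartitions : ℕ → ℕ → List (List (List ℕ))
planePartitions k n =
  filter (isPlanePartition? k n) (listsUpTo n (listsUpTo n (upTo (suc k))))

pl : ℕ → ℕ → ℕ
pl k n = length (planePartitions k n)

-- The enumeration contains exactly the plane partitions, each of them once.

private
  listsUpTo-unique : ∀ {A : Set} m {xs : List A} → Unique xs → Unique (listsUpTo m xs)
  listsUpTo-unique zero    u = [] ∷ []
  listsUpTo-unique (suc m) {xs} u =
    All.tabulate []∉ ∷ cartesianProductWith⁺ _∷_ ∷-injective u (listsUpTo-unique m u)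
    where
    []∉ : ∀ {ys} → ys ∈ cartesianProductWith _∷_ xs (listsUpTo m xs) → _
    []∉ p refl with ∈-cartesianProductWith⁻ _∷_ xs (listsUpTo m xs) p
    ... | _ , _ , _ , _ , ()

  ∈-listsUpTo : ∀ {A : Set} m {xs ys : List A} →
                All (_∈ xs) ys → length ys ≤ m → ys ∈ listsUpTo m xs
  ∈-listsUpTo zero    []       _         = here refl
  ∈-listsUpTo (suc m) []       _         = here refl
  ∈-listsUpTo (suc m) (y ∷ ys) (s≤s len) =
    there (∈-cartesianProductWith⁺ _∷_ y (∈-listsUpTo m ys len))

  length≤sum : ∀ {r} → All (0 <_) r → length r ≤ sum r
  length≤sum []       = z≤n
  length≤sum (p ∷ ps) = +-mono-≤ p (length≤sum ps)

  rows≤size : ∀ {π} → All (λ r → 0 < length r) π → All (All (0 <_)) π →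
              length π ≤ sum (map sum π)
  rows≤size []       []       = z≤n
  rows≤size (l ∷ ls) (p ∷ ps) =
    +-mono-≤ (≤-trans l (length≤sum p)) (rows≤size ls ps)

  row≤size : ∀ π → All (λ r → sum r ≤ sum (map sum π)) π
  row≤size []      = []
  row≤size (r ∷ π) =
    m≤m+n (sum r) _ ∷ All.map (λ le → ≤-trans le (m≤n+m _ (sum r))) (row≤size π)

planePartitions-unique : ∀ k n → Unique (planePartitions k n)
planePartitions-unique k n = filter⁺ (isPlanePartition? k n)
  (listsUpTo-unique n (listsUpTo-unique n (upTo⁺ (suc k))))

∈-planePartitions : ∀ k n {π} → π ∈ planePartitions k n ⇔ IsPlanePartition k n π
∈-planePartitions k n {π} = mk⇔
  (λ p → proj₂ (∈-filter⁻ (isPlanePartition? k n)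
                 {xs = listsUpTo n (listsUpTo n (upTo (suc k)))} p))
  (λ p → ∈-filter⁺ (isPlanePartition? k n) (candidate p) p)
  where
  candidate : IsPlanePartition k n π → π ∈ listsUpTo n (listsUpTo n (upTo (suc k)))
  candidate record { nonempty = ne ; positive = pos ; bounded = bd ; size = refl } =
    ∈-listsUpTo n
      (All.zipWith (λ (b , p , le) →
          ∈-listsUpTo n (All.map (λ x≤k → ∈-upTo⁺ (s≤s x≤k)) b)
                        (≤-trans (length≤sum p) le))
        (bd , All.zip (pos , row≤size π)))
      (rows≤size ne pos)

{-# OPTIONS --safe #-}

-- Counting, for each i ≤ k and each row, the entries that are at least i turns a plane
-- partition with entries at most k into a k × N array of naturals that decreases along rows
-- and columns. Its diagonals are interlacing partitions, and inverting Fomin's local rule one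
-- row at a time turns it into an arbitrary k × N matrix whose entry with indices a and s
-- (from 0) has weight a + s + 1. Hence, up to degree N, the generating function is the product
-- of the 1/(1 - x^(a+s+1)).
--
-- For k = p prime this is ∏_{m<p} (1 - x^m)^(p-m) times ∏_m (1 - x^m)^(-p), and modulo p the
-- second factor is a series in x^p. The congruences thus reduce to the vanishing modulo p, in
-- one residue class of exponents, of the coefficients of an explicit polynomial.

module Submission where

open import Defs
open import Data.Bool.Base using (Bool; true; _∧_; T)
open import Data.Bool.Properties using (T-∧)
open import Data.List.Base as List using (List; []; _∷_; _++_; length; foldr; foldl)
open import Data.List.Membership.Propositional using (_∈_)
open import Data.List.Membership.Propositional.Properties
  using (∈-map⁺; ∈-map⁻; ∈-++⁺ˡ; ∈-++⁺ʳ; ∈-++⁻; ∈-∃++)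
open import Data.List.Properties using (∷-injective; foldr-++; length-map; length-++)
open import Data.List.Relation.Binary.Prefix.Heterogeneous using (Prefix; []; _∷_)
open import Data.List.Relation.Binary.Prefix.Heterogeneous.Properties using (length-mono)
open import Data.List.Relation.Unary.All as All using (All; []; _∷_)
open import Data.List.Relation.Unary.AllPairs using ([]; _∷_)
open import Data.List.Relation.Unary.Any using (here; there)
open import Data.List.Relation.Unary.Linked using (Linked; []; [-]; _∷_)
open import Data.List.Relation.Unary.Unique.Propositional using (Unique)
open import Data.List.Relation.Unary.Unique.Propositional.Properties using (map⁺; ++⁺)
open import Data.Nat.Base
open import Data.Nat.DivMod
open import Data.Nat.Induction using (<-rec)
open import Data.Nat.ListAction using () renaming (sum to sumᴸ)
open import Data.Nat.Properties
open import Data.Nat.Tactic.RingSolver using (solve-∀)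
open import Data.Product.Base using (_×_; _,_; ∃; proj₁; proj₂)
open import Data.Product.Properties using (,-injectiveʳ)
open import Data.Sum.Base using (_⊎_; inj₁; inj₂)
open import Data.Unit.Base using (⊤; tt)
open import Data.Vec.Base as Vec
  using (Vec; []; _∷_; replicate; sum; map; tail; zipWith)
open import Data.Vec.Relation.Binary.Pointwise.Inductive using (Pointwise; []; _∷_)
open import Function.Base using (id; _∘_)
open import Function.Bundles using (Equivalence)
open import Relation.Binary.Bundles using (Setoid)
import Relation.Binary.Reasoning.Setoid as SetoidReasoning
open import Relation.Binary.PropositionalEquality
open import Relation.Nullary.Negation using (contradiction)

-- Power series

-- A plane partition of n has at most n rows, so no infinite product is ever formed: series are
-- compared only up to an index N, which is finally set to the index whose coefficient is wanted.
-- The cut-off also makes rows with different offsets comparable, because factors 1 - x^m with m > N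
-- are invisible below it. Coefficients stay natural numbers, with q = p - 1 standing for -1, so 1 -
-- x^m and its inverse cancel only modulo p. A linear relation between values at r + tp and at
-- indices just below it is a coefficient of the series times a small polynomial `cs`.
-- Multiplication by a series in x^p mixes only exponents of equal residue, so the relation for all
-- t follows from finitely many coefficients of `cs` times the numerator, and these are simply
-- evaluated. The identity (1 - x)^p ≡ 1 - x^p is likewise evaluated for p = 2, 3, 5, 7 instead of
-- being derived from primality.

Seq : Set
Seq = ℕ → ℕ

infixl 6 _⊕_
infixl 7 _⊙_

_⊕_ : Seq → Seq → Seq
(f ⊕ g) n = f n + g n

_⊙_ : ℕ → Seq → Seq
(c ⊙ f) n = c * f n

shift : ℕ → Seq → Seq
shift zero    f n       = f n
shift (suc w) f zero    = 0
shift (suc w) f (suc n) = shift w f n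

-- countdown v f c is the series x^c f / (1 - x^(1+v)).
countdown : ℕ → Seq → ℕ → Seq
countdown v f zero    zero    = f 0
countdown v f zero    (suc n) = f (suc n) + countdown v f v n
countdown v f (suc c) zero    = 0
countdown v f (suc c) (suc n) = countdown v f c n

-- Division by 1 - x^(1+v).
geom : ℕ → Seq → Seq
geom v f = countdown v f zero

countdown-shift : ∀ v f c n → countdown v f c n ≡ shift c (geom v f) n
countdown-shift v f zero    n       = refl
countdown-shift v f (suc c) zero    = refl
countdown-shift v f (suc c) (suc n) = countdown-shift v f c n

geom-unfold : ∀ v f n → geom v f n ≡ f n + shift (suc v) (geom v f) n
geom-unfold v f zero    = sym (+-identityʳ (f 0))
geom-unfold v f (suc n) = cong (f (suc n) +_) (countdown-shift v f v n)

-- Division by (1 - x^(a+1)) ⋯ (1 - x^(a+N)).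
geomRow : ℕ → ℕ → Seq → Seq
geomRow a zero    f = f
geomRow a (suc N) f = geom a (geomRow (suc a) N f)

geomRows : ℕ → ℕ → ℕ → Seq → Seq
geomRows N a zero    f = f
geomRows N a (suc k) f = geomRow a N (geomRows N (suc a) k f)

one : Seq
one zero    = 1
one (suc _) = 0

shift-⊕ : ∀ w f g n → shift w (f ⊕ g) n ≡ shift w f n + shift w g n
shift-⊕ zero    f g n       = refl
shift-⊕ (suc w) f g zero    = refl
shift-⊕ (suc w) f g (suc n) = shift-⊕ w f g n

shift-⊙ : ∀ w c f n → shift w (c ⊙ f) n ≡ c * shift w f n
shift-⊙ zero    c f n       = refl
shift-⊙ (suc w) c f zero    = sym (*-zeroʳ c)
shift-⊙ (suc w) c f (suc n) = shift-⊙ w c f n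

shift-+ : ∀ v w f n → shift v (shift w f) n ≡ shift (v + w) f n
shift-+ zero    w f n       = refl
shift-+ (suc v) w f zero    = refl
shift-+ (suc v) w f (suc n) = shift-+ v w f n

shift-small : ∀ w f n → n < w → shift w f n ≡ 0
shift-small (suc w) f zero    _         = refl
shift-small (suc w) f (suc n) (s≤s n<w) = shift-small w f n n<w

shift-view : ∀ w f n → (n < w × shift w f n ≡ 0) ⊎ ∃ λ m → n ≡ w + m × shift w f n ≡ f m
shift-view zero    f n       = inj₂ (n , refl , refl)
shift-view (suc w) f zero    = inj₁ (z<s , refl)
shift-view (suc w) f (suc n) with shift-view w f n
... | inj₁ (n<w , z)    = inj₁ (s<s n<w , z)
... | inj₂ (m , eq , e) = inj₂ (m , cong suc eq , e)

shift-cong : ∀ w {f g} → (∀ n → f n ≡ g n) → ∀ n → shift w f n ≡ shift w g n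
shift-cong zero    e n       = e n
shift-cong (suc w) e zero    = refl
shift-cong (suc w) e (suc n) = shift-cong w e n

iter : {A : Set} → ℕ → (A → A) → A → A
iter zero    F x = x
iter (suc j) F x = F (iter j F x)

-- Polynomials acting on series

_+ᴸ_ : List ℕ → List ℕ → List ℕ
[]       +ᴸ ds       = ds
(c ∷ cs) +ᴸ []       = c ∷ cs
(c ∷ cs) +ᴸ (d ∷ ds) = (c + d) ∷ (cs +ᴸ ds)

-- The action of the polynomial with coefficients cs in the variable x^w.
act : ℕ → List ℕ → Seq → Seq
act w []       f n = 0
act w (c ∷ cs) f n = c * f n + shift w (act w cs f) n


act-+ᴸ : ∀ w cs ds f n → act w (cs +ᴸ ds) f n ≡ act w cs f n + act w ds f n
act-+ᴸ w []       ds       f n = refl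
act-+ᴸ w (c ∷ cs) []       f n = sym (+-identityʳ _)
act-+ᴸ w (c ∷ cs) (d ∷ ds) f n = begin
  (c + d) * f n + shift w (act w (cs +ᴸ ds) f) n
    ≡⟨ cong ((c + d) * f n +_) (shift-cong w (act-+ᴸ w cs ds f) n) ⟩
  (c + d) * f n + shift w (act w cs f ⊕ act w ds f) n
    ≡⟨ cong ((c + d) * f n +_) (shift-⊕ w (act w cs f) (act w ds f) n) ⟩
  (c + d) * f n + (shift w (act w cs f) n + shift w (act w ds f) n)
    ≡⟨ rearrange c d (f n) _ _ ⟩
  c * f n + shift w (act w cs f) n + (d * f n + shift w (act w ds f) n) ∎
  where
  open ≡-Reasoning
  rearrange : ∀ c d x y z → (c + d) * x + (y + z) ≡ c * x + y + (d * x + z)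
  rearrange = solve-∀

act-scale : ∀ w c cs f n → act w (List.map (c *_) cs) f n ≡ c * act w cs f n
act-scale w c []       f n = sym (*-zeroʳ c)
act-scale w c (d ∷ cs) f n = begin
  c * d * f n + shift w (act w (List.map (c *_) cs) f) n
    ≡⟨ cong (c * d * f n +_) (shift-cong w (act-scale w c cs f) n) ⟩
  c * d * f n + shift w (c ⊙ act w cs f) n
    ≡⟨ cong (c * d * f n +_) (shift-⊙ w c (act w cs f) n) ⟩
  c * d * f n + c * shift w (act w cs f) n
    ≡⟨ rearrange c d (f n) _ ⟩
  c * (d * f n + shift w (act w cs f) n) ∎
  where
  open ≡-Reasoning
  rearrange : ∀ c d x y → c * d * x + c * y ≡ c * (d * x + y)
  rearrange = solve-∀

act-pad : ∀ w m cs f n → act w (List.replicate m 0 ++ cs) f n ≡ shift (m * w) (act w cs f) n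
act-pad w zero    cs f n = refl
act-pad w (suc m) cs f n = trans (shift-cong w (act-pad w m cs f) n) (shift-+ w (m * w) _ n)

-- Exposes the factor with the largest exponent, which `geomRow-suc` then discards.
geomRow-snoc : ∀ a n f → geomRow a (suc n) f ≡ geomRow a n (geom (a + n) f)
geomRow-snoc a zero    f = cong (λ v → geom v f) (sym (+-identityʳ a))
geomRow-snoc a (suc n) f = cong (geom a)
  (trans (geomRow-snoc (suc a) n f)
         (cong (λ v → geomRow (suc a) n (geom v f)) (sym (+-suc a n))))

countdownFrom : ℕ → List ℕ
countdownFrom zero    = []
countdownFrom (suc a) = suc a ∷ countdownFrom a

-- The exponents m of the factors 1 - x^m; in numerator 0 p each m < p occurs p - m times.
numerator : ℕ → ℕ → List ℕ
numerator a zero    = []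
numerator a (suc k) = countdownFrom a ++ numerator (suc a) k

module Coefficients (q : ℕ) where

  p : ℕ
  p = suc q

  -- Multiplication by 1 - x^m, with q in place of -1.
  mulD : ℕ → List ℕ → List ℕ
  mulD m cs = cs +ᴸ (List.replicate m 0 ++ List.map (q *_) cs)

  timesNumerator : List ℕ → List ℕ
  timesNumerator cs = foldl (λ ds m → mulD m ds) cs (numerator 0 p)

  -- (1 - x)^p ≡ 1 - x^p
  Frobenius : Set
  Frobenius = List.map (_% p) (iter p (mulD 1) (1 ∷ [])) ≡ List.map (_% p) (mulD p (1 ∷ []))

  -- good r cs: the coefficients of cs at the indices congruent to r vanish modulo p (for r ≤ q).
  good : ℕ → List ℕ → Bool
  good r       []       = true
  good zero    (c ∷ cs) = (c % p ≡ᵇ 0) ∧ good q cs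
  good (suc r) (c ∷ cs) = good r cs

-- Series modulo the number 1 + q, up to the coefficient of index N.
module Modular (q N : ℕ) where

  open Coefficients q

  infix 4 _≈_

  -- A record rather than a bare function type, so that `f` and `g` can be inferred from a proof of
  -- `f ≈ g`.
  record _≈_ (f g : Seq) : Set where
    constructor mk
    field at : ∀ {i} → i ≤ N → f i % p ≡ g i % p
  open _≈_

  +-cong-% : ∀ {a b c d} → a % p ≡ b % p → c % p ≡ d % p → (a + c) % p ≡ (b + d) % p
  +-cong-% {a} {b} {c} {d} x y = trans (%-distribˡ-+ a c p)
    (trans (cong₂ (λ u v → (u + v) % p) x y) (sym (%-distribˡ-+ b d p)))

  *-cong-% : ∀ {a b c d} → a % p ≡ b % p → c % p ≡ d % p → (a * c) % p ≡ (b * d) % p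
  *-cong-% {a} {b} {c} {d} x y = trans (%-distribˡ-* a c p)
    (trans (cong₂ (λ u v → (u * v) % p) x y) (sym (%-distribˡ-* b d p)))

  exact : ∀ {f g} → (∀ n → f n ≡ g n) → f ≈ g
  exact e = mk λ {i} _ → cong (_% p) (e i)

  seqSetoid : Setoid _ _
  seqSetoid = record
    { Carrier = Seq ; _≈_ = _≈_
    ; isEquivalence = record
      { refl  = mk λ _ → refl
      ; sym   = λ e → mk λ i≤N → sym (at e i≤N)
      ; trans = λ d e → mk λ i≤N → trans (at d i≤N) (at e i≤N) } }

  open Setoid seqSetoid using () renaming (refl to ≈-refl; sym to ≈-sym; trans to ≈-trans)
  module ≈-Reasoning = SetoidReasoning seqSetoid

  ⊕-cong : ∀ {f f′ g g′} → f ≈ f′ → g ≈ g′ → f ⊕ g ≈ f′ ⊕ g′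
  ⊕-cong {f} {f′} {g} {g′} d e = mk λ {i} i≤N → +-cong-% {f i} {f′ i} {g i} {g′ i} (at d i≤N) (at e i≤N)

  ⊙-cong : ∀ c {f g} → f ≈ g → c ⊙ f ≈ c ⊙ g
  ⊙-cong c {f} {g} e = mk λ {i} i≤N → *-cong-% {c} {c} {f i} {g i} refl (at e i≤N)

  shift-cong-% : ∀ w {f g} n → (∀ {i} → i ≤ n → f i % p ≡ g i % p) →
                 shift w f n % p ≡ shift w g n % p
  shift-cong-% zero    n       e = e ≤-refl
  shift-cong-% (suc w) zero    e = refl
  shift-cong-% (suc w) (suc n) e = shift-cong-% w n (λ i≤n → e (m≤n⇒m≤1+n i≤n))

  shift-cong-≈ : ∀ w {f g} → f ≈ g → shift w f ≈ shift w g
  shift-cong-≈ w e = mk λ {i} i≤N → shift-cong-% w i (λ j≤i → at e (≤-trans j≤i i≤N))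

  drop-p : ∀ f g → f ⊕ p ⊙ g ≈ f
  drop-p f g = mk λ {i} _ →
    trans (cong (λ x → (f i + x) % p) (*-comm p (g i))) ([m+kn]%n≡m%n (f i) (g i) p)

  -- In effect, multiplication by a fixed power series. The four laws are what is needed to commute
  -- `F` with every `geom v` and `D m`, so no pair of operators has to be treated separately.
  record Linear (F : Seq → Seq) : Set where
    field
      congr     : ∀ {f g} → f ≈ g → F f ≈ F g
      additive  : ∀ f g → F (f ⊕ g) ≈ F f ⊕ F g
      scalar    : ∀ c f → F (c ⊙ f) ≈ c ⊙ F f
      shifting  : ∀ w f → F (shift w f) ≈ shift w (F f)
  open Linear

  id-linear : Linear id
  id-linear = record
    { congr = id ; additive = λ _ _ → ≈-refl ; scalar = λ _ _ → ≈-refl ; shifting = λ _ _ → ≈-refl }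

  ∘-linear : ∀ {F G} → Linear F → Linear G → Linear (F ∘ G)
  ∘-linear l m = record
    { congr    = λ e → congr l (congr m e)
    ; additive = λ f g → ≈-trans (congr l (additive m f g)) (additive l _ _)
    ; scalar   = λ c f → ≈-trans (congr l (scalar m c f)) (scalar l c _)
    ; shifting = λ w f → ≈-trans (congr l (shifting m w f)) (shifting l w _)
    }

  iter-linear : ∀ j {F} → Linear F → Linear (iter j F)
  iter-linear zero    l = id-linear
  iter-linear (suc j) l = ∘-linear l (iter-linear j l)

  zero-linear : Linear (λ _ _ → 0)
  zero-linear = record
    { congr    = λ _ → ≈-refl
    ; additive = λ _ _ → ≈-refl
    ; scalar   = λ c _ → exact λ _ → sym (*-zeroʳ c)
    ; shifting = λ w _ → exact (shift-zero w)
    }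
    where
    shift-zero : ∀ w n → 0 ≡ shift w (λ _ → 0) n
    shift-zero zero    n       = refl
    shift-zero (suc w) zero    = refl
    shift-zero (suc w) (suc n) = shift-zero w n

  ⊕-linear : ∀ {F G} → Linear F → Linear G → Linear (λ f → F f ⊕ G f)
  ⊕-linear {F} {G} l m = record
    { congr    = λ e → ⊕-cong (congr l e) (congr m e)
    ; additive = λ f g → ≈-trans (⊕-cong (additive l f g) (additive m f g))
                   (exact λ n → +-interchange (F f n) (F g n) (G f n) (G g n))
    ; scalar   = λ c f → ≈-trans (⊕-cong (scalar l c f) (scalar m c f))
                   (exact λ n → sym (*-distribˡ-+ c (F f n) (G f n)))
    ; shifting = λ w f → ≈-trans (⊕-cong (shifting l w f) (shifting m w f))
                   (exact λ n → sym (shift-⊕ w (F f) (G f) n))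
    }
    where
    +-interchange : ∀ a b c d → a + b + (c + d) ≡ a + c + (b + d)
    +-interchange = solve-∀

  ⊙-linear : ∀ c → Linear (c ⊙_)
  ⊙-linear c = record
    { congr    = ⊙-cong c
    ; additive = λ f g → exact λ n → *-distribˡ-+ c (f n) (g n)
    ; scalar   = λ d f → exact λ n → swap c d (f n)
    ; shifting = λ w f → exact λ n → sym (shift-⊙ w c f n)
    }
    where
    swap : ∀ c d x → c * (d * x) ≡ d * (c * x)
    swap = solve-∀

  shift-linear : ∀ v → Linear (shift v)
  shift-linear v = record
    { congr    = shift-cong-≈ v
    ; additive = λ f g → exact (shift-⊕ v f g)
    ; scalar   = λ c f → exact (shift-⊙ v c f)
    ; shifting = λ w f → exact λ n → trans (shift-+ v w f n)
        (trans (cong (λ u → shift u f n) (+-comm v w)) (sym (shift-+ w v f n)))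
    }

  act-linear : ∀ w cs → Linear (act w cs)
  act-linear w []       = zero-linear
  act-linear w (c ∷ cs) =
    ⊕-linear (⊙-linear c) (∘-linear (shift-linear w) (act-linear w cs))

  -- Coefficient i of the shifted series involves only coefficients below i, so the recursion
  -- determines `g`. Every later property of `geom` is obtained by verifying this recursion.
  geom-unique : ∀ {v f g} → g ≈ f ⊕ shift (suc v) g → g ≈ geom v f
  geom-unique {v} {f} {g} e = mk λ {i} → <-rec (λ i → i ≤ N → g i % p ≡ geom v f i % p) step i
    where
    step : ∀ i → (∀ {j} → j < i → j ≤ N → g j % p ≡ geom v f j % p) →
           i ≤ N → g i % p ≡ geom v f i % p
    step i rec i≤N = trans (at e i≤N)
      (trans (+-cong-% {f i} {f i} refl (shifted i rec i≤N)) (cong (_% p) (sym (geom-unfold v f i))))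
      where
      shifted : ∀ i → (∀ {j} → j < i → j ≤ N → g j % p ≡ geom v f j % p) → i ≤ N →
             shift (suc v) g i % p ≡ shift (suc v) (geom v f) i % p
      shifted zero    rec i≤N = refl
      shifted (suc i) rec i≤N =
        shift-cong-% v i (λ j≤i → rec (s≤s j≤i) (≤-trans j≤i (<⇒≤ i≤N)))

  geom-cong : ∀ v {f g} → f ≈ g → geom v f ≈ geom v g
  geom-cong v {f} e = geom-unique (≈-trans (exact (geom-unfold v f)) (⊕-cong e ≈-refl))

  geom-commute : ∀ {F} → Linear F → ∀ v f → F (geom v f) ≈ geom v (F f)
  geom-commute {F} l v f = geom-unique (begin
    F (geom v f)                              ≈⟨ congr l (exact (geom-unfold v f)) ⟩
    F (f ⊕ shift (suc v) (geom v f))          ≈⟨ additive l _ _ ⟩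
    F f ⊕ F (shift (suc v) (geom v f))        ≈⟨ ⊕-cong ≈-refl (shifting l (suc v) (geom v f)) ⟩
    F f ⊕ shift (suc v) (F (geom v f))        ∎)
    where open ≈-Reasoning

  geom-linear : ∀ v → Linear (geom v)
  geom-linear v = record
    { congr    = geom-cong v
    ; additive = λ f g → ≈-sym (geom-unique (≈-trans
        (exact λ n → trans (cong₂ _+_ (geom-unfold v f n) (geom-unfold v g n))
                           (rearrange (f n) _ (g n) _))
        (⊕-cong ≈-refl (≈-sym (shift-⊕≈ (geom v f) (geom v g))))))
    ; scalar   = λ c f → ≈-sym (geom-commute (⊙-linear c) v f)
    ; shifting = λ w f → ≈-sym (geom-commute (shift-linear w) v f)
    }
    where
    shift-⊕≈ : ∀ f g → shift (suc v) (f ⊕ g) ≈ shift (suc v) f ⊕ shift (suc v) g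
    shift-⊕≈ f g = exact (shift-⊕ (suc v) f g)
    rearrange : ∀ a b c d → a + b + (c + d) ≡ a + c + (b + d)
    rearrange = solve-∀

  geom-trivial : ∀ {v} f → N ≤ v → geom v f ≈ f
  geom-trivial {v} f N≤v = ≈-sym (geom-unique (mk λ {i} i≤N → cong (_% p)
    (sym (trans (cong (f i +_) (shift-small (suc v) f i (s≤s (≤-trans i≤N N≤v))))
                (+-identityʳ (f i))))))

  -- The counterpart of `mulD` on series: multiplication by 1 - x^m modulo p.
  D : ℕ → Seq → Seq
  D m f = f ⊕ q ⊙ shift m f

  D-linear : ∀ m → Linear (D m)
  D-linear m = ⊕-linear id-linear (∘-linear (⊙-linear q) (shift-linear m))

  D-commute : ∀ {F} → Linear F → ∀ m f → F (D m f) ≈ D m (F f)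
  D-commute l m f = ≈-trans (additive l _ _)
    (⊕-cong ≈-refl (≈-trans (scalar l q (shift m f)) (⊙-cong q (shifting l m f))))

  D-geom : ∀ v f → D (suc v) (geom v f) ≈ f
  D-geom v f = ≈-trans
    (exact λ n → trans (cong (_+ q * shift (suc v) (geom v f) n) (geom-unfold v f n))
                       (+-assoc (f n) _ _))
    (drop-p f (shift (suc v) (geom v f)))

  -- Adding `p ⊙ shift (suc v) g` costs nothing modulo p; of its 1 + q copies, q complete
  -- `D (suc v) g` and the last one yields the recursion of `geom`.
  divide : ∀ {v f g} → D (suc v) g ≈ f → g ≈ geom v f
  divide {v} {f} {g} e = geom-unique (begin
    g                                       ≈⟨ drop-p g (shift (suc v) g) ⟨
    g ⊕ p ⊙ shift (suc v) g                 ≈⟨ exact (λ n → rearrange (g n) _ q) ⟩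
    D (suc v) g ⊕ shift (suc v) g           ≈⟨ ⊕-cong e ≈-refl ⟩
    f ⊕ shift (suc v) g                     ∎)
    where
    open ≈-Reasoning
    rearrange : ∀ a b q → a + suc q * b ≡ a + q * b + b
    rearrange = solve-∀

  act-mulD : ∀ w m cs f → act w (mulD m cs) f ≈ D (m * w) (act w cs f)
  act-mulD w m cs f = exact λ n → trans (act-+ᴸ w cs _ f n)
    (cong (act w cs f n +_) (trans (act-pad w m _ f n)
      (trans (shift-cong (m * w) (act-scale w q cs f) n) (shift-⊙ (m * w) q _ n))))

  act-one : ∀ w f → act w (1 ∷ []) f ≈ f
  act-one w f = ≈-trans (⊕-cong (exact λ n → *-identityˡ (f n)) (≈-sym (shifting zero-linear w f)))
    (exact λ n → +-identityʳ (f n))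

  act-cong-% : ∀ w {cs ds} → List.map (_% p) cs ≡ List.map (_% p) ds → ∀ f → act w cs f ≈ act w ds f
  act-cong-% w {[]}     {[]}     e f = ≈-refl
  act-cong-% w {c ∷ cs} {d ∷ ds} e f = ⊕-cong
    (mk λ {i} _ → *-cong-% {c} {d} {f i} {f i} (proj₁ (∷-injective e)) refl)
    (shift-cong-≈ w (act-cong-% w (proj₂ (∷-injective e)) f))

  -- The coefficients of (1 - y)^j do not depend on what is substituted for y. Hence the one
  -- evaluated identity `Frobenius` serves every y = x^w.
  D-power : ∀ j w f → iter j (D w) f ≈ act w (iter j (mulD 1) (1 ∷ [])) f
  D-power zero    w f = ≈-sym (act-one w f)
  D-power (suc j) w f = ≈-trans (congr (D-linear w) (D-power j w f))
    (≈-sym (subst (λ m → act w (mulD 1 cs) f ≈ D m (act w cs f)) (*-identityˡ w)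
                  (act-mulD w 1 cs f)))
    where cs = iter j (mulD 1) (1 ∷ [])

  D-geom-power : ∀ j v f → iter j (D (suc v)) (iter j (geom v) f) ≈ f
  D-geom-power zero    v f = ≈-refl
  D-geom-power (suc j) v f = begin
    D (suc v) (Dʲ (geom v (iter j (geom v) f))) ≈⟨ congr (D-linear (suc v)) (geom-commute (iter-linear j (D-linear (suc v))) v _) ⟩
    D (suc v) (geom v (Dʲ (iter j (geom v) f))) ≈⟨ D-geom v _ ⟩
    Dʲ (iter j (geom v) f)                      ≈⟨ D-geom-power j v f ⟩
    f                                           ∎
    where
    open ≈-Reasoning
    Dʲ = iter j (D (suc v))

  foldD : List ℕ → Seq → Seq
  foldD ms f = foldr D f ms

  foldD-linear : ∀ ms → Linear (foldD ms)
  foldD-linear []       = id-linear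
  foldD-linear (m ∷ ms) = ∘-linear (D-linear m) (foldD-linear ms)

  -- Moves the factors 1 - x^m one by one from the series into the polynomial, where they can be
  -- multiplied out by evaluation.
  act-foldD : ∀ ms cs f → act 1 cs (foldD ms f) ≈ act 1 (foldl (λ ds m → mulD m ds) cs ms) f
  act-foldD []       cs f = ≈-refl
  act-foldD (m ∷ ms) cs f = begin
    act 1 cs (D m (foldD ms f))      ≈⟨ D-commute (act-linear 1 cs) m _ ⟩
    D m (act 1 cs (foldD ms f))      ≈⟨ subst (λ m′ → act 1 (mulD m cs) (foldD ms f) ≈ D m′ (act 1 cs (foldD ms f)))
                                         (*-identityʳ m) (act-mulD 1 m cs _) ⟨
    act 1 (mulD m cs) (foldD ms f)   ≈⟨ act-foldD ms (mulD m cs) f ⟩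
    _                                ∎
    where open ≈-Reasoning

  -- Reducing all rows to powers of the first row

  geomRow-linear : ∀ a n → Linear (geomRow a n)
  geomRow-linear a zero    = id-linear
  geomRow-linear a (suc n) = ∘-linear (geom-linear a) (geomRow-linear (suc a) n)

  -- The two rows differ by the factor of exponent a + 1 at the near end and that of exponent a + N
  -- + 1 at the far end. The latter exceeds N and is trivial below the cut-off.
  geomRow-suc : ∀ a f → geomRow (suc a) N f ≈ D (suc a) (geomRow a N f)
  geomRow-suc a f = begin
    geomRow (suc a) N f                       ≈⟨ D-geom a _ ⟨
    D (suc a) (geomRow a (suc N) f)           ≡⟨ cong (D (suc a)) (geomRow-snoc a N f) ⟩
    D (suc a) (geomRow a N (geom (a + N) f))  ≈⟨ congr (D-linear (suc a)) (congr (geomRow-linear a N) (geom-trivial f (m≤n+m N a))) ⟩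
    D (suc a) (geomRow a N f)                 ∎
    where open ≈-Reasoning

  geomRow-0 : ∀ a f → geomRow a N f ≈ foldD (countdownFrom a) (geomRow 0 N f)
  geomRow-0 zero    f = ≈-refl
  geomRow-0 (suc a) f = ≈-trans (geomRow-suc a f) (congr (D-linear (suc a)) (geomRow-0 a f))

  geomRows-power : ∀ a k f → geomRows N a k f ≈ foldD (numerator a k) (iter k (geomRow 0 N) f)
  geomRows-power a zero    f = ≈-refl
  geomRows-power a (suc k) f = begin
    geomRow a N (geomRows N (suc a) k f)         ≈⟨ geomRow-0 a _ ⟩
    E (Q (geomRows N (suc a) k f))               ≈⟨ congr (foldD-linear (countdownFrom a)) (congr (geomRow-linear 0 N) (geomRows-power (suc a) k f)) ⟩
    E (Q (foldD (numerator (suc a) k) (iter k Q f))) ≈⟨ congr (foldD-linear (countdownFrom a)) (foldD-commute (numerator (suc a) k) _) ⟩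
    E (foldD (numerator (suc a) k) (Q (iter k Q f))) ≡⟨ foldr-++ D _ (countdownFrom a) (numerator (suc a) k) ⟨
    foldD (numerator a (suc k)) (iter (suc k) Q f) ∎
    where
    open ≈-Reasoning
    E = foldD (countdownFrom a)
    Q = geomRow 0 N
    foldD-commute : ∀ ms f → Q (foldD ms f) ≈ foldD ms (Q f)
    foldD-commute []       f = ≈-refl
    foldD-commute (m ∷ ms) f =
      ≈-trans (D-commute (geomRow-linear 0 N) m _) (congr (D-linear m) (foldD-commute ms f))

  geom-power-commute : ∀ {F} → Linear F → ∀ j v f → F (iter j (geom v) f) ≈ iter j (geom v) (F f)
  geom-power-commute l zero    v f = ≈-refl
  geom-power-commute l (suc j) v f =
    ≈-trans (geom-commute l v _) (geom-cong v (geom-power-commute l j v f))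

  -- Splits the power of a row into powers of its single factors, since `geom-frobenius` handles one
  -- factor at a time.
  geomRow-power : ∀ j a n f →
    iter j (geomRow a (suc n)) f ≈ iter j (geom a) (iter j (geomRow (suc a) n) f)
  geomRow-power zero    a n f = ≈-refl
  geomRow-power (suc j) a n f = geom-cong a
    (≈-trans (congr (geomRow-linear (suc a) n) (geomRow-power j a n f))
             (geom-power-commute (geomRow-linear (suc a) n) j a _))

  -- Series in x^p modulo p

  Sparse : Seq → Set
  Sparse f = ∀ i → i ≤ N → i % p ≢ 0 → f i % p ≡ 0

  sparse-≈ : ∀ {f g} → f ≈ g → Sparse g → Sparse f
  sparse-≈ e s i i≤N ≢0 = trans (at e i≤N) (s i i≤N ≢0)

  sparse-one : Sparse one
  sparse-one zero    _ ≢0 = contradiction refl ≢0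
  sparse-one (suc i) _ ≢0 = refl

  -- The index is written `v + q * suc v` because its successor unfolds to `p * suc v`. The
  -- recursion of `geom` thus descends by a multiple of p and preserves the residue of the index.
  sparse-geom : ∀ v {f} → Sparse f → Sparse (geom (v + q * suc v) f)
  sparse-geom v {f} s = <-rec (λ i → i ≤ N → i % p ≢ 0 → g i % p ≡ 0) step
    where
    w = v + q * suc v
    g = geom w f
    step : ∀ i → (∀ {j} → j < i → j ≤ N → j % p ≢ 0 → g j % p ≡ 0) →
           i ≤ N → i % p ≢ 0 → g i % p ≡ 0
    step i rec i≤N ≢0 = trans (cong (_% p) (geom-unfold w f i))
      (+-cong-% {f i} {0} {_} {0} (s i i≤N ≢0) shifted)
      where
      shifted : shift (suc w) g i % p ≡ 0
      shifted with shift-view (suc w) g i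
      ... | inj₁ (_ , z) = cong (_% p) z
      ... | inj₂ (m , eq , e) = trans (cong (_% p) e)
        (rec m<i (≤-trans (<⇒≤ m<i) i≤N) λ m≡0 → ≢0 (trans i%p m≡0))
        where
        m<i : m < i
        m<i = subst (m <_) (sym eq) (s≤s (m≤n+m m w))
        i%p : i % p ≡ m % p
        i%p = trans (cong (_% p) (trans eq (trans (+-comm (suc w) m) (cong (m +_) (*-comm p (suc v))))))
                    ([m+kn]%n≡m%n m (suc v) p)

  -- Walking along `cs` lowers the index of `g` by one each time. While the residue is positive the
  -- factor from `g` vanishes; when it is 0, `good` makes the coefficient vanish, and the residue
  -- restarts at q.
  act-good : ∀ {g} → Sparse g → ∀ cs r t → r ≤ q → r + t * p ≤ N → T (good r cs) →
             act 1 cs g (r + t * p) % p ≡ 0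
  act-good s []       r       t       r≤q le ok = refl
  act-good {g} s (c ∷ cs) zero t r≤q le ok =
    +-cong-% {c * g (t * p)} {0} {_} {0}
      (*-cong-% {c} {0} {g (t * p)} {g (t * p)} (≡ᵇ⇒≡ _ _ (proj₁ (Equivalence.to T-∧ ok))) refl)
      (rest t le)
    where
    rest : ∀ t → t * p ≤ N → shift 1 (act 1 cs g) (t * p) % p ≡ 0
    rest zero    le = refl
    -- `suc t * p` unfolds to `suc (q + t * p)`, so one step down lands on residue q with t in place
    -- of suc t.
    rest (suc t) le = act-good s cs q t ≤-refl (<⇒≤ le) (proj₂ (Equivalence.to T-∧ ok))
  act-good {g} s (c ∷ cs) (suc r) t r≤q le ok =
    +-cong-% {c * g i} {0} {_} {0}
      (trans (*-cong-% {c} {c} {g i} {0} refl (s i le i%p≢0)) (cong (_% p) (*-zeroʳ c)))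
      (act-good s cs r t (<⇒≤ r≤q) (<⇒≤ le) ok)
    where
    i = suc r + t * p
    i%p≢0 : i % p ≢ 0
    i%p≢0 i%p≡0 with trans (sym i%p≡0) (trans ([m+kn]%n≡m%n (suc r) t p) (m<n⇒m%n≡m (s≤s r≤q)))
    ... | ()

  module _ (frobenius : Frobenius) where

    -- Multiplying the left side by 1 - x^(pw), which is (1 - x^w)^p modulo p, cancels all p
    -- divisions.
    geom-frobenius : ∀ v f → iter p (geom v) f ≈ geom (v + q * suc v) f
    geom-frobenius v f = divide (begin
      D (p * w) g                         ≈⟨ congr (D-linear (p * w)) (act-one w g) ⟨
      D (p * w) (act w (1 ∷ []) g)        ≈⟨ act-mulD w p (1 ∷ []) g ⟨
      act w (mulD p (1 ∷ [])) g           ≈⟨ act-cong-% w frobenius g ⟨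
      act w (iter p (mulD 1) (1 ∷ [])) g  ≈⟨ D-power p w g ⟨
      iter p (D w) g                      ≈⟨ D-geom-power p v f ⟩
      f                                   ∎)
      where
      open ≈-Reasoning
      w = suc v
      g = iter p (geom v) f

    sparse-power : ∀ a n {f} → Sparse f → Sparse (iter p (geomRow a n) f)
    sparse-power a zero    {f} s = subst Sparse (sym (iter-id p)) s
      where
      iter-id : ∀ j → iter j (geomRow a 0) f ≡ f
      iter-id zero    = refl
      iter-id (suc j) = iter-id j
    sparse-power a (suc n) s = sparse-≈
      (≈-trans (geomRow-power p a n _) (geom-frobenius a _))
      (sparse-geom a (sparse-power (suc a) n s))

    geomRows-congruence : ∀ cs r t → r ≤ q → r + t * p ≤ N →
      T (good r (timesNumerator cs)) →
      act 1 cs (geomRows N 0 p one) (r + t * p) % p ≡ 0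
    geomRows-congruence cs r t r≤q le ok = trans
      (at (≈-trans (congr (act-linear 1 cs) (geomRows-power 0 p one))
                   (act-foldD (numerator 0 p) cs _)) le)
      (act-good (sparse-power 0 N sparse-one)
        (timesNumerator cs) r t r≤q le ok)

-- Interlacing sequences and the RSK correspondence

private variable
  k N m n : ℕ
  A B : Set

-- The default 0 stands for the missing parts of a partition, so the interlacing conditions also
-- make sense at the end of a vector.
hd : Vec ℕ k → ℕ
hd []      = 0
hd (x ∷ _) = x

zeros : ∀ k → Vec ℕ k
zeros k = replicate k 0

infix 4 _≽_
infixr 5 _∷_

-- x₁ ≥ y₁ ≥ x₂ ≥ y₂ ≥ ⋯
data _≽_ : Vec ℕ m → Vec ℕ n → Set where
  []  : [] ≽ []
  _∷_ : {x : ℕ} {xs : Vec ℕ m} {ys : Vec ℕ n} → hd ys ≤ x → ys ≽ xs → x ∷ xs ≽ ys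

zeros-≽-zeros : ∀ k → zeros k ≽ zeros k
zeros-suc-≽-zeros : ∀ k → zeros (suc k) ≽ zeros k
zeros-≽-zeros zero    = []
zeros-≽-zeros (suc k) = z≤n ∷ zeros-suc-≽-zeros k
zeros-suc-≽-zeros zero    = z≤n ∷ []
zeros-suc-≽-zeros (suc k) = z≤n ∷ zeros-≽-zeros (suc k)

zeros-suc-≽ : {v : Vec ℕ k} → zeros (suc k) ≽ v → v ≡ zeros k
zeros-suc-≽ {v = []}    _               = refl
zeros-suc-≽ {v = _ ∷ _} (z≤n ∷ (_ ∷ p)) = cong (0 ∷_) (zeros-suc-≽ p)

-- Fomin's local rule: the part l ⊓ u ∸ k of κ is reflected in the interval to which
-- interlacing with λ and μ confines it, and the largest part absorbs m.
grow : ℕ → Vec ℕ k → Vec ℕ k → Vec ℕ (suc k) → Vec ℕ (suc k)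
grow m []       []       (u ∷ []) = u + m ∷ []
grow m (k ∷ ks) (l ∷ ls) (u ∷ us) = l ⊔ u + m ∷ grow (l ⊓ u ∸ k) ks ls us

-- The reflection solved for the part of κ: the excess of the next part of ν over `hd ls ⊔ hd us` is
-- subtracted from `l ⊓ u`. The largest part of ν carries m, which `increments` reads off.
shrink : Vec ℕ (suc k) → Vec ℕ k → Vec ℕ (suc k) → Vec ℕ k
shrink _        []       _        = []
shrink (_ ∷ ns) (l ∷ ls) (u ∷ us) =
  l ⊓ u ∸ (hd ns ∸ (hd ls ⊔ hd us)) ∷ shrink ns ls us

hd-grow : ∀ m (κ λ′ : Vec ℕ k) μ → hd (grow m κ λ′ μ) ≡ hd λ′ ⊔ hd μ + m
hd-grow m []      []      (_ ∷ []) = refl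
hd-grow m (_ ∷ _) (_ ∷ _) (_ ∷ _)  = refl

-- Interlacing places the part k of κ between `hd ls ⊔ hd us` and `l ⊓ u`, and reflection maps this
-- interval to itself.
grow-≽ : ∀ m {κ λ′ : Vec ℕ k} {μ} → λ′ ≽ κ → μ ≽ κ → grow m κ λ′ μ ≽ λ′ × grow m κ λ′ μ ≽ μ
grow-≽ m {[]} {[]} {u ∷ []} _ _ = z≤n ∷ [] , m≤m+n u m ∷ z≤n ∷ []
grow-≽ m {k ∷ ks} {l ∷ ls} {u ∷ us} (k≤l ∷ (ls≤k ∷ p)) (k≤u ∷ (us≤k ∷ q)) =
  ( (≤-trans (m≤m⊔n l u) (m≤m+n _ m) ∷ (≤-trans bound (m⊓n≤m l u) ∷ proj₁ rec))
  , (≤-trans (m≤n⊔m l u) (m≤m+n _ m) ∷ (≤-trans bound (m⊓n≤n l u) ∷ proj₂ rec)))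
  where
  rec = grow-≽ (l ⊓ u ∸ k) p q
  bound : hd (grow (l ⊓ u ∸ k) ks ls us) ≤ l ⊓ u
  bound = begin
    hd (grow (l ⊓ u ∸ k) ks ls us)  ≡⟨ hd-grow _ ks ls us ⟩
    hd ls ⊔ hd us + (l ⊓ u ∸ k)     ≤⟨ +-monoˡ-≤ _ (⊔-lub ls≤k us≤k) ⟩
    k + (l ⊓ u ∸ k)                 ≡⟨ m+[n∸m]≡n (⊓-glb k≤l k≤u) ⟩
    l ⊓ u                           ∎
    where open ≤-Reasoning

shrink-≽ : {ν : Vec ℕ (suc k)} {λ′ : Vec ℕ k} {μ : Vec ℕ (suc k)} → ν ≽ λ′ → ν ≽ μ →
           λ′ ≽ shrink ν λ′ μ × μ ≽ shrink ν λ′ μ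
shrink-≽ {ν = _ ∷ []} {[]} {_ ∷ []} _ _ = [] , z≤n ∷ []
shrink-≽ {ν = n ∷ ns} {l ∷ ls} {u ∷ us} (_ ∷ (ns≤l ∷ p)) (_ ∷ (ns≤u ∷ q)) =
  ( ≤-trans κ≤ (m⊓n≤m l u) ∷ (≤-trans (m≤m⊔n _ (hd us)) ≤κ ∷ proj₁ rec)
  , ≤-trans κ≤ (m⊓n≤n l u) ∷ (≤-trans (m≤n⊔m (hd ls) _) ≤κ ∷ proj₂ rec))
  where
  rec = shrink-≽ p q
  e = hd ns ∸ (hd ls ⊔ hd us)
  κ≤ : l ⊓ u ∸ e ≤ l ⊓ u
  κ≤ = m∸n≤m (l ⊓ u) e
  hd-≤ : ∀ {i j} {xs : Vec ℕ (suc i)} {ys : Vec ℕ j} → xs ≽ ys → hd ys ≤ hd xs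
  hd-≤ (y≤x ∷ _) = y≤x
  max≤ : hd ls ⊔ hd us ≤ hd ns
  max≤ = ⊔-lub (hd-≤ p) (hd-≤ q)
  ≤κ : hd ls ⊔ hd us ≤ l ⊓ u ∸ e
  ≤κ = begin
    hd ls ⊔ hd us                 ≡⟨ m+n∸n≡m _ e ⟨
    hd ls ⊔ hd us + e ∸ e         ≡⟨ cong (_∸ e) (m+[n∸m]≡n max≤) ⟩
    hd ns ∸ e                     ≤⟨ ∸-monoˡ-≤ e (⊓-glb ns≤l ns≤u) ⟩
    l ⊓ u ∸ e                     ∎
    where open ≤-Reasoning

shrink-grow : ∀ m {κ λ′ : Vec ℕ k} {μ} → λ′ ≽ κ → μ ≽ κ → shrink (grow m κ λ′ μ) λ′ μ ≡ κ
shrink-grow m {[]} {[]} {_ ∷ []} _ _ = refl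
shrink-grow m {k ∷ ks} {l ∷ ls} {u ∷ us} (k≤l ∷ (_ ∷ p)) (k≤u ∷ (_ ∷ q)) =
  cong₂ _∷_ reflected (shrink-grow (l ⊓ u ∸ k) p q)
  where
  max = hd ls ⊔ hd us
  reflected : l ⊓ u ∸ (hd (grow (l ⊓ u ∸ k) ks ls us) ∸ max) ≡ k
  reflected = begin
    l ⊓ u ∸ (hd (grow (l ⊓ u ∸ k) ks ls us) ∸ max) ≡⟨ cong (λ x → l ⊓ u ∸ (x ∸ max)) (hd-grow _ ks ls us) ⟩
    l ⊓ u ∸ (max + (l ⊓ u ∸ k) ∸ max)              ≡⟨ cong (l ⊓ u ∸_) (m+n∸m≡n max _) ⟩
    l ⊓ u ∸ (l ⊓ u ∸ k)                            ≡⟨ m∸[m∸n]≡n (⊓-glb k≤l k≤u) ⟩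
    k                                              ∎
    where open ≡-Reasoning

grow-shrink : {ν : Vec ℕ (suc k)} {λ′ : Vec ℕ k} {μ : Vec ℕ (suc k)} → ν ≽ λ′ → ν ≽ μ →
              grow (hd ν ∸ (hd λ′ ⊔ hd μ)) (shrink ν λ′ μ) λ′ μ ≡ ν
grow-shrink {ν = n ∷ []} {[]} {u ∷ []} _ (u≤n ∷ _) = cong (_∷ []) (m+[n∸m]≡n u≤n)
grow-shrink {ν = n ∷ ns} {l ∷ ls} {u ∷ us} (l≤n ∷ (ns≤l ∷ p)) (u≤n ∷ (ns≤u ∷ q)) =
  cong₂ _∷_ (m+[n∸m]≡n (⊔-lub l≤n u≤n))
    (trans (cong (λ x → grow x (shrink ns ls us) ls us)
                 (m∸[m∸n]≡n (≤-trans (m∸n≤m (hd ns) (hd ls ⊔ hd us)) (⊓-glb ns≤l ns≤u))))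
           (grow-shrink p q))

-- A reflected part and its original add up to a minimum at one index and a maximum at the next.
-- Regrouped by index, minimum and maximum give the parts of λ and μ.
sum-grow : ∀ m {κ λ′ : Vec ℕ k} {μ} → λ′ ≽ κ → μ ≽ κ →
           sum (grow m κ λ′ μ) + sum κ ≡ m + (sum λ′ + sum μ)
sum-grow m {[]} {[]} {u ∷ []} _ _ = rearrange u m
  where
  rearrange : ∀ u m → u + m + 0 + 0 ≡ m + (0 + (u + 0))
  rearrange = solve-∀
sum-grow m {k ∷ ks} {l ∷ ls} {u ∷ us} (k≤l ∷ (_ ∷ p)) (k≤u ∷ (_ ∷ q)) = begin
  l ⊔ u + m + sum ν + (k + sum ks)       ≡⟨ rearrange₁ (l ⊔ u) m (sum ν) k (sum ks) ⟩
  m + (l ⊔ u + k + (sum ν + sum ks))     ≡⟨ cong (λ s → m + (l ⊔ u + k + s)) (sum-grow _ p q) ⟩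
  m + (l ⊔ u + k + (e + (sum ls + sum us)))
                                         ≡⟨ rearrange₂ m (l ⊔ u) k e (sum ls) (sum us) ⟩
  m + (l ⊔ u + (k + e) + (sum ls + sum us))
    ≡⟨ cong (λ s → m + (l ⊔ u + s + (sum ls + sum us))) (m+[n∸m]≡n (⊓-glb k≤l k≤u)) ⟩
  m + (l ⊔ u + l ⊓ u + (sum ls + sum us)) ≡⟨ cong (λ s → m + (s + (sum ls + sum us))) (⊔+⊓ l u) ⟩
  m + (l + u + (sum ls + sum us))        ≡⟨ rearrange₃ m l u (sum ls) (sum us) ⟩
  m + (l + sum ls + (u + sum us))        ∎
  where
  open ≡-Reasoning
  e = l ⊓ u ∸ k
  ν = grow e ks ls us
  ⊔+⊓ : ∀ l u → l ⊔ u + l ⊓ u ≡ l + u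
  ⊔+⊓ zero    u       = +-identityʳ u
  ⊔+⊓ (suc l) zero    = refl
  ⊔+⊓ (suc l) (suc u) = cong suc (trans (+-suc _ _) (trans (cong suc (⊔+⊓ l u)) (sym (+-suc l u))))
  rearrange₁ : ∀ a m s k t → a + m + s + (k + t) ≡ m + (a + k + (s + t))
  rearrange₁ = solve-∀
  rearrange₂ : ∀ m a k e s t → m + (a + k + (e + (s + t))) ≡ m + (a + (k + e) + (s + t))
  rearrange₂ = solve-∀
  rearrange₃ : ∀ m l u s t → m + (l + u + (s + t)) ≡ m + (l + s + (u + t))
  rearrange₃ = solve-∀

-- Chains of diagonals and the insertion of one matrix row

top : Vec (Vec ℕ k) N → Vec ℕ k
top []      = zeros _
top (d ∷ _) = d

total : Vec (Vec ℕ k) N → ℕ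
total []       = 0
total (d ∷ ds) = sum d + total ds

data Chain {k} : Vec (Vec ℕ k) N → Set where
  []  : Chain []
  _∷_ : {d : Vec ℕ k} {ds : Vec (Vec ℕ k) N} → d ≽ top ds → Chain ds → Chain (d ∷ ds)

-- One strip of a growth diagram, filled from the far end, where both chains are zero. In each
-- square λ and κ are consecutive members of the old chain, ν and μ of the new one.
growRow : Vec (Vec ℕ k) N → Vec ℕ N → Vec (Vec ℕ (suc k)) N
growRow []       []       = []
growRow (l ∷ as) (m ∷ ms) = grow m (top as) l (top bs) ∷ bs
  where bs = growRow as ms

-- The strip is undone from the near end: ν, μ and λ = `l` are known, and the κ they determine is
-- the λ of the next square. So the first diagonal of the old chain suffices to recover all of it.
shrinkRow : Vec (Vec ℕ (suc k)) N → Vec ℕ k → Vec (Vec ℕ k) N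
shrinkRow []       _ = []
shrinkRow (ν ∷ bs) l = l ∷ shrinkRow bs (shrink ν l (top bs))

increments : Vec (Vec ℕ (suc k)) N → Vec ℕ k → Vec ℕ N
increments []       _ = []
increments (ν ∷ bs) l = hd ν ∸ (hd l ⊔ hd (top bs)) ∷ increments bs (shrink ν l (top bs))

growRow-chain : ∀ {α : Vec (Vec ℕ k) N} (ms : Vec ℕ N) → Chain α →
                Chain (growRow α ms) × top (growRow α ms) ≽ top α
growRow-chain []       []      = [] , zeros-suc-≽-zeros _
growRow-chain (m ∷ ms) (p ∷ c) =
  let c′ , q = growRow-chain ms c
      r  , s = grow-≽ m p q
  in s ∷ c′ , r

top-shrinkRow : ∀ {β : Vec (Vec ℕ (suc k)) N} {l} → top β ≽ l → top (shrinkRow β l) ≡ l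
top-shrinkRow {β = []}    p = sym (zeros-suc-≽ p)
top-shrinkRow {β = _ ∷ _} p = refl

shrinkRow-chain : ∀ {β : Vec (Vec ℕ (suc k)) N} {l} → Chain β → top β ≽ l → Chain (shrinkRow β l)
shrinkRow-chain []      _ = []
shrinkRow-chain {β = _ ∷ bs} (q ∷ c) p with r , s ← shrink-≽ p q =
  subst (_ ≽_) (sym (top-shrinkRow {β = bs} s)) r ∷ shrinkRow-chain c s

growRow-shrinkRow : ∀ {β : Vec (Vec ℕ (suc k)) N} {l} → Chain β → top β ≽ l →
                    growRow (shrinkRow β l) (increments β l) ≡ β
growRow-shrinkRow []                      _ = refl
growRow-shrinkRow {β = ν ∷ bs} {l} (q ∷ c) p with r , s ← shrink-≽ p q
  rewrite growRow-shrinkRow c s | top-shrinkRow {β = bs} s = cong (_∷ bs) (grow-shrink p q)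

shrinkRow-growRow : ∀ {α : Vec (Vec ℕ k) N} (ms : Vec ℕ N) → Chain α →
                    shrinkRow (growRow α ms) (top α) ≡ α × increments (growRow α ms) (top α) ≡ ms
shrinkRow-growRow []       []      = refl , refl
shrinkRow-growRow {α = l ∷ as} (m ∷ ms) (p ∷ c)
  with q ← proj₂ (growRow-chain ms c) | e , f ← shrinkRow-growRow ms c
  rewrite shrink-grow m p q | hd-grow m (top as) l (top (growRow as ms)) =
  cong (l ∷_) e , cong₂ _∷_ (m+n∸m≡n (hd l ⊔ hd (top (growRow as ms))) m) f

rowWeight : ℕ → Vec ℕ N → ℕ
rowWeight a []       = 0
rowWeight a (m ∷ ms) = suc a * m + rowWeight (suc a) ms

sum-zeros : ∀ k → sum (zeros k) ≡ 0
sum-zeros zero    = refl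
sum-zeros (suc k) = sum-zeros k

-- `sum-grow` telescopes from the far end: each square adds its m to the difference of the two sums.
sum-top-growRow : ∀ {α : Vec (Vec ℕ k) N} (ms : Vec ℕ N) → Chain α →
                  sum (top (growRow α ms)) ≡ sum (top α) + sum ms
sum-top-growRow {k = k} [] [] = trans (sum-zeros k) (sym (trans (+-identityʳ _) (sum-zeros k)))
sum-top-growRow {α = l ∷ as} (m ∷ ms) (p ∷ c) = +-cancelʳ-≡ (sum (top as)) _ _ (begin
  sum (grow m (top as) l (top bs)) + sum (top as)  ≡⟨ sum-grow m p (proj₂ (growRow-chain ms c)) ⟩
  m + (sum l + sum (top bs))                       ≡⟨ cong (λ s → m + (sum l + s)) (sum-top-growRow ms c) ⟩
  m + (sum l + (sum (top as) + sum ms))            ≡⟨ rearrange m (sum l) (sum (top as)) (sum ms) ⟩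
  sum l + (m + sum ms) + sum (top as)              ∎)
  where
  open ≡-Reasoning
  bs = growRow as ms
  rearrange : ∀ m l a s → m + (l + (a + s)) ≡ l + (m + s) + a
  rearrange = solve-∀

-- By `sum-top-growRow` the entry of column s enlarges the diagonals 0 to s, so it counts s + 1
-- times. The offset a supplies the rest of the weight and absorbs the passage to the next column in
-- the induction.
total-growRow : ∀ a {α : Vec (Vec ℕ k) N} (ms : Vec ℕ N) → Chain α →
                total (growRow α ms) + a * sum ms ≡ total α + rowWeight a ms
total-growRow a []       []      = *-zeroʳ a
total-growRow a {α = l ∷ as} (m ∷ ms) (p ∷ c) = begin
  sum (top (growRow (l ∷ as) (m ∷ ms))) + total bs + a * (m + sum ms)
    ≡⟨ cong (λ s → s + total bs + a * (m + sum ms)) (sum-top-growRow (m ∷ ms) (p ∷ c)) ⟩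
  sum l + (m + sum ms) + total bs + a * (m + sum ms)
    ≡⟨ rearrange₁ (sum l) m (sum ms) (total bs) a ⟩
  sum l + suc a * m + (total bs + suc a * sum ms)
    ≡⟨ cong (sum l + suc a * m +_) (total-growRow (suc a) ms c) ⟩
  sum l + suc a * m + (total as + rowWeight (suc a) ms)
    ≡⟨ rearrange₂ (sum l) (suc a * m) (total as) _ ⟩
  sum l + total as + (suc a * m + rowWeight (suc a) ms) ∎
  where
  open ≡-Reasoning
  bs = growRow as ms
  rearrange₁ : ∀ l m s b a → l + (m + s) + b + a * (m + s) ≡ l + suc a * m + (b + suc a * s)
  rearrange₁ = solve-∀
  rearrange₂ : ∀ l x t r → l + x + (t + r) ≡ l + t + (x + r)
  rearrange₂ = solve-∀

-- Triangle k holds the diagonals starting in the first column, of lengths k - 1, …, 0.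
Triangle : ℕ → Set
Triangle zero    = ⊤
Triangle (suc k) = Vec ℕ k × Triangle k

InTriangle : Vec ℕ k → Triangle k → Set
InTriangle {zero}  v _       = ⊤
InTriangle {suc k} v (e , t) = v ≽ e × InTriangle e t

triangleSum : Triangle k → ℕ
triangleSum {zero}  _       = 0
triangleSum {suc k} (e , t) = sum e + triangleSum t

-- A k × N array cut into its diagonals.
Diagonals : ℕ → ℕ → Set
Diagonals k N = Vec (Vec ℕ k) N × Triangle k

Interlacing : Diagonals k N → Set
Interlacing (ds , t) = Chain ds × InTriangle (top ds) t

-- The rows are inserted from the last to the first. Before each insertion the main diagonal goes
-- into the triangle, being what `shrinkRow` needs to undo the insertion.
rsk : Vec (Vec ℕ N) k → Diagonals k N
rsk []       = replicate _ [] , tt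
rsk (ms ∷ M) = let α , t = rsk M in growRow α ms , top α , t

rsk⁻¹ : ∀ {k} → Diagonals k N → Vec (Vec ℕ N) k
rsk⁻¹ {k = zero}  _           = []
rsk⁻¹ {k = suc k} (β , e , t) = increments β e ∷ rsk⁻¹ (shrinkRow β e , t)

empty-≽ : (u v : Vec ℕ 0) → u ≽ v
empty-≽ [] [] = []

empty-chain : ∀ N → Chain (replicate N [])
empty-chain zero    = []
empty-chain (suc N) = empty-≽ _ _ ∷ empty-chain N

empty-unique : (ds : Vec (Vec ℕ 0) N) → replicate N [] ≡ ds
empty-unique []        = refl
empty-unique ([] ∷ ds) = cong ([] ∷_) (empty-unique ds)

rsk-interlacing : (M : Vec (Vec ℕ N) k) → Interlacing (rsk M)
rsk-interlacing []       = empty-chain _ , tt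
rsk-interlacing (ms ∷ M) =
  let c  , i = rsk-interlacing M
      c′ , p = growRow-chain ms c
  in c′ , p , i

rsk⁻¹-rsk : (M : Vec (Vec ℕ N) k) → rsk⁻¹ (rsk M) ≡ M
rsk⁻¹-rsk []       = refl
rsk⁻¹-rsk (ms ∷ M) with e , f ← shrinkRow-growRow ms (proj₁ (rsk-interlacing M))
  rewrite e | f = cong (ms ∷_) (rsk⁻¹-rsk M)

rsk-rsk⁻¹ : (d : Diagonals k N) → Interlacing d → rsk (rsk⁻¹ d) ≡ d
rsk-rsk⁻¹ {k = zero}  (ds , tt)   _           = cong (_, tt) (empty-unique ds)
rsk-rsk⁻¹ {k = suc k} (β , e , t) (c , p , i)
  rewrite rsk-rsk⁻¹ (shrinkRow β e , t)
            (shrinkRow-chain c p , subst (λ v → InTriangle v t) (sym (top-shrinkRow {β = β} p)) i)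
        | growRow-shrinkRow c p | top-shrinkRow {β = β} p = refl

weight : ℕ → Vec (Vec ℕ N) k → ℕ
weight a []       = 0
weight a (ms ∷ M) = rowWeight a ms + weight (suc a) M

volume : Diagonals k N → ℕ
volume (ds , t) = total ds + triangleSum t

total-empty : (ds : Vec (Vec ℕ 0) N) → total ds ≡ 0
total-empty []        = refl
total-empty ([] ∷ ds) = total-empty ds

-- Here a counts the rows still to be inserted. Each insertion stores a main diagonal, to which the
-- present entries contribute `sum (top (proj₁ (rsk M)))` once more; this accounts for the row index
-- in the weight.
volume-rsk-offset : ∀ a (M : Vec (Vec ℕ N) k) →
                  volume (rsk M) + a * sum (top (proj₁ (rsk M))) ≡ weight a M
volume-rsk-offset {N = N} a [] = trans
  (cong₂ (λ x v → x + 0 + a * sum v) (total-empty (replicate N [])) (empty (top (replicate N []))))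
  (*-zeroʳ a)
  where
  empty : (v : Vec ℕ 0) → v ≡ []
  empty [] = refl
volume-rsk-offset a (ms ∷ M) = begin
  total β + (s + triangleSum t) + a * sum (top β)
    ≡⟨ cong (λ x → total β + (s + triangleSum t) + a * x) (sum-top-growRow ms c) ⟩
  total β + (s + triangleSum t) + a * (s + sum ms)
    ≡⟨ rearrange₁ (total β) s (triangleSum t) a (sum ms) ⟩
  total β + a * sum ms + (triangleSum t + suc a * s)
    ≡⟨ cong (_+ (triangleSum t + suc a * s)) (total-growRow a ms c) ⟩
  total α + rowWeight a ms + (triangleSum t + suc a * s)
    ≡⟨ rearrange₂ (total α) (rowWeight a ms) (triangleSum t) _ ⟩
  rowWeight a ms + (total α + triangleSum t + suc a * s)
    ≡⟨ cong (rowWeight a ms +_) (volume-rsk-offset (suc a) M) ⟩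
  rowWeight a ms + weight (suc a) M ∎
  where
  open ≡-Reasoning
  α = proj₁ (rsk M)
  t = proj₂ (rsk M)
  β = growRow α ms
  c = proj₁ (rsk-interlacing M)
  s = sum (top α)
  rearrange₁ : ∀ b s t a m → b + (s + t) + a * (s + m) ≡ b + a * m + (t + suc a * s)
  rearrange₁ = solve-∀
  rearrange₂ : ∀ x r t y → x + r + (t + y) ≡ r + (x + t + y)
  rearrange₂ = solve-∀

volume-rsk : (M : Vec (Vec ℕ N) k) → volume (rsk M) ≡ weight 0 M
volume-rsk M = trans (sym (+-identityʳ _)) (volume-rsk-offset 0 M)

-- Diagonals of an array

data Decreasing : Vec ℕ k → Set where
  []  : Decreasing []
  _∷_ : {x : ℕ} {xs : Vec ℕ k} → hd xs ≤ x → Decreasing xs → Decreasing (x ∷ xs)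

data Columns {k} : Vec (Vec ℕ k) N → Set where
  []  : Columns []
  col : {c : Vec ℕ k} {cs : Vec (Vec ℕ k) N} →
        Decreasing c → Pointwise _≤_ (top cs) c → Columns cs → Columns (c ∷ cs)

-- Below the first row, the diagonal starting in column s continues as the diagonal of the remaining
-- array that starts in column s + 1. The first diagonal drops out, and `pushDown` reinserts it.
shiftUp : Vec (Vec ℕ k) N → Vec (Vec ℕ k) N
shiftUp []       = []
shiftUp (_ ∷ as) = top as ∷ shiftUp as

pushDown : Vec ℕ k → Vec (Vec ℕ k) N → Vec (Vec ℕ k) N
pushDown e []       = []
pushDown e (d ∷ ds) = e ∷ pushDown d ds

-- The diagonals of an array with first row r arise from those of the array without it:
-- each but the first of the latter gets an entry of r in front.
cut : Vec (Vec ℕ k) N → Diagonals k N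
cut {k = zero}  cs = cs , tt
cut {k = suc k} cs = let α , t = cut (map tail cs) in
  zipWith _∷_ (map hd cs) (shiftUp α) , top α , t

cut⁻¹ : Diagonals k N → Vec (Vec ℕ k) N
cut⁻¹ {k = zero}  (ds , _)     = ds
cut⁻¹ {k = suc k} (ds , e , t) = zipWith _∷_ (map hd ds) (cut⁻¹ (pushDown e (map tail ds) , t))

map-hd-zip : (hs : Vec ℕ N) (cs : Vec (Vec ℕ k) N) → map hd (zipWith _∷_ hs cs) ≡ hs
map-hd-zip []       []       = refl
map-hd-zip (h ∷ hs) (_ ∷ cs) = cong (h ∷_) (map-hd-zip hs cs)

map-tail-zip : (hs : Vec ℕ N) (cs : Vec (Vec ℕ k) N) → map tail (zipWith _∷_ hs cs) ≡ cs
map-tail-zip []       []       = refl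
map-tail-zip (_ ∷ hs) (c ∷ cs) = cong (c ∷_) (map-tail-zip hs cs)

zip-hd-tail : (cs : Vec (Vec ℕ (suc k)) N) → zipWith _∷_ (map hd cs) (map tail cs) ≡ cs
zip-hd-tail []             = refl
zip-hd-tail ((_ ∷ _) ∷ cs) = cong (_ ∷_) (zip-hd-tail cs)

pushDown-shiftUp : (α : Vec (Vec ℕ k) N) → pushDown (top α) (shiftUp α) ≡ α
pushDown-shiftUp []       = refl
pushDown-shiftUp (a ∷ as) = cong (a ∷_) (pushDown-shiftUp as)

cut⁻¹-cut : (cs : Vec (Vec ℕ k) N) → cut⁻¹ (cut cs) ≡ cs
cut⁻¹-cut {k = zero}  cs = refl
cut⁻¹-cut {k = suc k} cs
  rewrite map-hd-zip (map hd cs) (shiftUp (proj₁ (cut (map tail cs))))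
        | map-tail-zip (map hd cs) (shiftUp (proj₁ (cut (map tail cs))))
        | pushDown-shiftUp (proj₁ (cut (map tail cs)))
        | cut⁻¹-cut (map tail cs) = zip-hd-tail cs

hd-cut : (cs : Vec (Vec ℕ k) N) → map hd (proj₁ (cut cs)) ≡ map hd cs
hd-cut {k = zero}  cs = refl
hd-cut {k = suc k} cs = map-hd-zip (map hd cs) _

hd-cut⁻¹ : (d : Diagonals k N) → map hd (cut⁻¹ d) ≡ map hd (proj₁ d)
hd-cut⁻¹ {k = zero}  d            = refl
hd-cut⁻¹ {k = suc k} (ds , e , t) = map-hd-zip (map hd ds) _

zip-≽ : {hs : Vec ℕ N} {α : Vec (Vec ℕ k) N} → Pointwise _≤_ (map hd α) hs → Chain α →
        top (zipWith _∷_ hs (shiftUp α)) ≽ top α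
zip-≽ {hs = []}    {[]}    _       _       = zeros-suc-≽-zeros _
zip-≽ {hs = _ ∷ _} {_ ∷ _} (h ∷ _) (p ∷ _) = h ∷ p

zip-chain : {hs : Vec ℕ N} {α : Vec (Vec ℕ k) N} → Decreasing hs →
            Pointwise _≤_ (map hd α) hs → Chain α → Chain (zipWith _∷_ hs (shiftUp α))
zip-chain {hs = []}     {[]}     _       _        _       = []
zip-chain {hs = h ∷ hs} {a ∷ as} (q ∷ d) (_ ∷ le) (_ ∷ c) =
  (hd-top hs as q ∷ zip-≽ le c) ∷ zip-chain d le c
  where
  hd-top : ∀ {N} (hs : Vec ℕ N) (as : Vec (Vec ℕ _) N) → hd hs ≤ h →
           hd (top (zipWith _∷_ hs (shiftUp as))) ≤ h
  hd-top []      []      _ = z≤n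
  hd-top (_ ∷ _) (_ ∷ _) q = q

Pointwise-hd : ∀ {u v : Vec ℕ k} → Pointwise _≤_ u v → hd u ≤ hd v
Pointwise-hd []      = z≤n
Pointwise-hd (p ∷ _) = p

hd-top≡ : (cs : Vec (Vec ℕ (suc k)) N) → hd (top cs) ≡ hd (map hd cs)
hd-top≡ []      = refl
hd-top≡ (_ ∷ _) = refl

tail-top : (cs : Vec (Vec ℕ (suc k)) N) → tail (top cs) ≡ top (map tail cs)
tail-top []      = refl
tail-top (_ ∷ _) = refl

top-zip : (hs : Vec ℕ N) (cs : Vec (Vec ℕ k) N) → top (zipWith _∷_ hs cs) ≡ hd hs ∷ top cs
top-zip []      []      = refl
top-zip (_ ∷ _) (_ ∷ _) = refl

columns-hd : {cs : Vec (Vec ℕ (suc k)) N} → Columns cs → Decreasing (map hd cs)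
columns-hd []             = []
columns-hd {cs = _ ∷ cs} (col d le c) =
  subst (_≤ _) (hd-top≡ cs) (Pointwise-hd le) ∷ columns-hd c

columns-tail : {cs : Vec (Vec ℕ (suc k)) N} → Columns cs → Columns (map tail cs)
columns-tail [] = []
columns-tail {cs = (_ ∷ _) ∷ cs} (col (_ ∷ d) le c) =
  col d (subst (λ v → Pointwise _≤_ v _) (tail-top cs) (tail-≤ le)) (columns-tail c)
  where
  tail-≤ : ∀ {u v : Vec ℕ (suc k)} → Pointwise _≤_ u v → Pointwise _≤_ (tail u) (tail v)
  tail-≤ (_ ∷ le) = le

columns-hd-tail : {cs : Vec (Vec ℕ (suc k)) N} → Columns cs →
                  Pointwise _≤_ (map hd (map tail cs)) (map hd cs)
columns-hd-tail [] = []
columns-hd-tail {cs = (_ ∷ _) ∷ _} (col (le ∷ _) _ c) = le ∷ columns-hd-tail c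

columns-zip : {hs : Vec ℕ N} {cs : Vec (Vec ℕ k) N} → Decreasing hs →
              Pointwise _≤_ (map hd cs) hs → Columns cs → Columns (zipWith _∷_ hs cs)
columns-zip {hs = []}     {[]}     _       _        _            = []
columns-zip {hs = h ∷ hs} {c ∷ cs} (q ∷ d) (r ∷ le) (col e p cs′) =
  col (r ∷ e) (subst (λ v → Pointwise _≤_ v (h ∷ c)) (sym (top-zip hs cs)) (q ∷ p))
      (columns-zip d le cs′)

cut-interlacing : {cs : Vec (Vec ℕ k) N} → Columns cs → Interlacing (cut cs)
cut-interlacing {k = zero} {cs = cs} c = subst Chain (empty-unique cs) (empty-chain _) , tt
cut-interlacing {k = suc k} {cs = cs} c =
  let ch , i = cut-interlacing (columns-tail c)
      le     = subst (λ v → Pointwise _≤_ v (map hd cs)) (sym (hd-cut (map tail cs))) (columns-hd-tail c)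
  in zip-chain (columns-hd c) le ch , zip-≽ le ch , i

top-pushDown : {ds : Vec (Vec ℕ (suc k)) N} {e : Vec ℕ k} → top ds ≽ e →
               top (pushDown e (map tail ds)) ≡ e
top-pushDown {ds = []}    p = sym (zeros-suc-≽ p)
top-pushDown {ds = _ ∷ _} p = refl

≽-tail : {v : Vec ℕ (suc k)} {w : Vec ℕ (suc k)} → v ≽ w → w ≽ tail v
≽-tail (_ ∷ p) = p

pushDown-chain : {ds : Vec (Vec ℕ (suc k)) N} {e : Vec ℕ k} → Chain ds → top ds ≽ e →
                 Chain (pushDown e (map tail ds))
pushDown-chain []      _       = []
pushDown-chain {ds = _ ∷ ds} (q ∷ c) (_ ∷ p) =
  subst (_ ≽_) (sym (top-pushDown {ds = ds} (≽-tail q))) p ∷ pushDown-chain c (≽-tail q)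

-- `shiftUp` ends with a zero diagonal. The last tail is zero as well, since interlacing with the
-- zeros past column N forces it.
shiftUp-pushDown : {ds : Vec (Vec ℕ (suc k)) N} {e : Vec ℕ k} → Chain ds → top ds ≽ e →
                   shiftUp (pushDown e (map tail ds)) ≡ map tail ds
shiftUp-pushDown []      _ = refl
shiftUp-pushDown {ds = _ ∷ ds} (q ∷ c) _ =
  cong₂ _∷_ (top-pushDown {ds = ds} (≽-tail q)) (shiftUp-pushDown c (≽-tail q))

pushDown-hd : {ds : Vec (Vec ℕ (suc k)) N} {e : Vec ℕ k} → Chain ds → top ds ≽ e →
              Pointwise _≤_ (map hd (pushDown e (map tail ds))) (map hd ds)
pushDown-hd []      _       = []
pushDown-hd (q ∷ c) (p ∷ _) = p ∷ pushDown-hd c (≽-tail q)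

chain-hd : {ds : Vec (Vec ℕ (suc k)) N} → Chain ds → Decreasing (map hd ds)
chain-hd [] = []
chain-hd {ds = (_ ∷ _) ∷ ds} ((le ∷ _) ∷ c) = subst (_≤ _) (hd-top≡ ds) le ∷ chain-hd c

cut-cut⁻¹ : (d : Diagonals k N) → Interlacing d → cut (cut⁻¹ d) ≡ d
cut-cut⁻¹ {k = zero}  (ds , tt)    _           = refl
cut-cut⁻¹ {k = suc k} (ds , e , t) (c , p , i)
  rewrite map-hd-zip (map hd ds) (cut⁻¹ (pushDown e (map tail ds) , t))
        | map-tail-zip (map hd ds) (cut⁻¹ (pushDown e (map tail ds) , t))
        | cut-cut⁻¹ (pushDown e (map tail ds) , t)
            (pushDown-chain c p , subst (λ v → InTriangle v t) (sym (top-pushDown {ds = ds} p)) i)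
        | shiftUp-pushDown c p | top-pushDown {ds = ds} p | zip-hd-tail ds = refl

cut⁻¹-columns : (d : Diagonals k N) → Interlacing d → Columns (cut⁻¹ d)
cut⁻¹-columns {k = zero}  (ds , tt)    _           = subst Columns (empty-unique ds) (empty-columns _)
  where
  empty-≤ : (u v : Vec ℕ 0) → Pointwise _≤_ u v
  empty-≤ [] [] = []
  empty-columns : ∀ N → Columns (replicate N [])
  empty-columns zero    = []
  empty-columns (suc N) = col [] (empty-≤ _ _) (empty-columns N)
cut⁻¹-columns {k = suc k} (ds , e , t) (c , p , i) = columns-zip (chain-hd c)
  (subst (λ v → Pointwise _≤_ v _) (sym (hd-cut⁻¹ d)) (pushDown-hd c p))
  (cut⁻¹-columns d (pushDown-chain c p , subst (λ v → InTriangle v t) (sym (top-pushDown {ds = ds} p)) i))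
  where d = pushDown e (map tail ds) , t

total-zip : (hs : Vec ℕ N) (cs : Vec (Vec ℕ k) N) → total (zipWith _∷_ hs cs) ≡ sum hs + total cs
total-zip []       []       = refl
total-zip (h ∷ hs) (c ∷ cs) = trans (cong (h + sum c +_) (total-zip hs cs))
                                    (rearrange h (sum c) (sum hs) (total cs))
  where
  rearrange : ∀ h c s t → h + c + (s + t) ≡ h + s + (c + t)
  rearrange = solve-∀

total-shiftUp : (α : Vec (Vec ℕ k) N) → total (shiftUp α) + sum (top α) ≡ total α
total-shiftUp {k = k} [] = sum-zeros k
total-shiftUp (a ∷ as) = trans (cong (_+ sum a) (trans (+-comm (sum (top as)) _) (total-shiftUp as)))
                               (+-comm (total as) (sum a))

volume-cut : (cs : Vec (Vec ℕ k) N) → volume (cut cs) ≡ total cs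
volume-cut {k = zero}  cs = +-identityʳ _
volume-cut {k = suc k} cs = begin
  total (zipWith _∷_ (map hd cs) (shiftUp α)) + (sum (top α) + triangleSum t)
    ≡⟨ cong (_+ (sum (top α) + triangleSum t)) (total-zip (map hd cs) (shiftUp α)) ⟩
  sum (map hd cs) + total (shiftUp α) + (sum (top α) + triangleSum t)
    ≡⟨ rearrange (sum (map hd cs)) _ (sum (top α)) _ ⟩
  sum (map hd cs) + (total (shiftUp α) + sum (top α) + triangleSum t)
    ≡⟨ cong (λ s → sum (map hd cs) + (s + triangleSum t)) (total-shiftUp α) ⟩
  sum (map hd cs) + volume (cut (map tail cs))
    ≡⟨ cong (sum (map hd cs) +_) (volume-cut (map tail cs)) ⟩
  sum (map hd cs) + total (map tail cs)
    ≡⟨ total-zip (map hd cs) (map tail cs) ⟨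
  total (zipWith _∷_ (map hd cs) (map tail cs))
    ≡⟨ cong total (zip-hd-tail cs) ⟩
  total cs ∎
  where
  open ≡-Reasoning
  α = proj₁ (cut (map tail cs))
  t = proj₂ (cut (map tail cs))
  rearrange : ∀ h a b t → h + a + (b + t) ≡ h + (a + b + t)
  rearrange = solve-∀

-- Plane partitions as arrays

-- Each entry becomes the bound for the rest, so one parameter expresses both the upper bound and
-- the decrease of the row.
data Row : ℕ → List ℕ → Set where
  []  : ∀ {b} → Row b []
  row : ∀ {b x r} → 1 ≤ x → x ≤ b → Row x r → Row b (x ∷ r)

-- Removes the lowest layer. In a decreasing row the ones form a final segment, so everything from
-- the first one onwards can be cut off.
peel : List ℕ → List ℕ
peel []                = []
peel (zero        ∷ r) = []
peel (suc zero    ∷ r) = []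
peel (suc (suc x) ∷ r) = suc x ∷ peel r

-- The length `a` has to be supplied because `peel` forgets how many ones it removed.
unpeel : ℕ → List ℕ → List ℕ
unpeel a []      = List.replicate a 1
unpeel a (x ∷ r) = suc x ∷ unpeel (a ∸ 1) r

-- The conjugate partition: the entry with index i (from 0) counts the entries of r exceeding i.
layers : ∀ k → List ℕ → Vec ℕ k
layers zero    r = []
layers (suc k) r = length r ∷ layers k (peel r)

layers⁻¹ : Vec ℕ k → List ℕ
layers⁻¹ []      = []
layers⁻¹ (a ∷ v) = unpeel a (layers⁻¹ v)

_⊑_ : List ℕ → List ℕ → Set
_⊑_ = Prefix _≤_

row-ones : ∀ {r} → Row 1 r → r ≡ List.replicate (length r) 1
row-ones []                              = refl
row-ones (row (s≤s z≤n) (s≤s z≤n) ρ) = cong (1 ∷_) (row-ones ρ)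

sum-ones : ∀ a → sumᴸ (List.replicate a 1) ≡ a
sum-ones zero    = refl
sum-ones (suc a) = cong suc (sum-ones a)

peel-row : ∀ {b r} → Row (suc b) r → Row b (peel r)
peel-row []                                    = []
peel-row (row {x = suc zero}    _ _       ρ) = []
peel-row (row {x = suc (suc x)} _ (s≤s q) ρ) = row (s≤s z≤n) q (peel-row ρ)

length-peel : ∀ r → length (peel r) ≤ length r
length-peel []                = z≤n
length-peel (zero        ∷ r) = z≤n
length-peel (suc zero    ∷ r) = z≤n
length-peel (suc (suc x) ∷ r) = s≤s (length-peel r)

peel-mono : ∀ {s r} → s ⊑ r → peel s ⊑ peel r
peel-mono []                                                  = []
peel-mono {zero        ∷ _}                       (_ ∷ _)     = []
peel-mono {suc zero    ∷ _}                       (_ ∷ _)     = []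
peel-mono {suc (suc x) ∷ _} {suc (suc y) ∷ _} (s≤s p ∷ ps) = p ∷ peel-mono ps
peel-mono {suc (suc x) ∷ _} {suc zero    ∷ _} (s≤s () ∷ _)

sum-peel : ∀ {b r} → Row b r → length r + sumᴸ (peel r) ≡ sumᴸ r
sum-peel [] = refl
sum-peel (row {x = suc zero} {r} _ _ ρ) = cong suc (trans (+-identityʳ (length r))
  (sym (trans (cong sumᴸ (row-ones ρ)) (sum-ones (length r)))))
sum-peel (row {x = suc (suc x)} {r} _ _ ρ) =
  trans (rearrange (length r) x _) (cong (suc (suc x) +_) (sum-peel ρ))
  where
  rearrange : ∀ l x s → suc l + (suc x + s) ≡ suc (suc x) + (l + s)
  rearrange = solve-∀

unpeel-peel : ∀ {b r} → Row b r → unpeel (length r) (peel r) ≡ r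
unpeel-peel []                                 = refl
unpeel-peel (row {x = suc zero}    _ _ ρ) = cong (1 ∷_) (sym (row-ones ρ))
unpeel-peel (row {x = suc (suc x)} _ _ ρ) = cong (suc (suc x) ∷_) (unpeel-peel ρ)

peel-unpeel : ∀ {b s} a → Row b s → peel (unpeel a s) ≡ s
peel-unpeel zero    []                   = refl
peel-unpeel (suc a) []                   = refl
peel-unpeel a (row {x = suc x} _ _ ρ) = cong (suc x ∷_) (peel-unpeel (a ∸ 1) ρ)

length-unpeel : ∀ {a} s → length s ≤ a → length (unpeel a s) ≡ a
length-unpeel {zero}  []      _         = refl
length-unpeel {suc a} []      _         = cong suc (length-unpeel {a} [] z≤n)
length-unpeel {suc a} (_ ∷ s) (s≤s le) = cong suc (length-unpeel s le)

unpeel-row : ∀ {b s} a → Row b s → Row (suc b) (unpeel a s)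
unpeel-row zero    []            = []
unpeel-row (suc a) []            = row ≤-refl (s≤s z≤n) (unpeel-row {zero} a [])
unpeel-row a       (row p q ρ) = row (s≤s z≤n) (s≤s q) (unpeel-row (a ∸ 1) ρ)

unpeel-mono : ∀ {a b s r} → a ≤ b → s ⊑ r → unpeel a s ⊑ unpeel b r
unpeel-mono {r = r}      z≤n      []       = []
unpeel-mono {r = []}     (s≤s le) []       = ≤-refl ∷ unpeel-mono le []
unpeel-mono {r = x ∷ r}  (s≤s le) []       = s≤s z≤n ∷ unpeel-mono {r = r} le []
unpeel-mono              le       (p ∷ ps) = s≤s p ∷ unpeel-mono (∸-monoˡ-≤ 1 le) ps

layers-decreasing : ∀ k r → Decreasing (layers k r)
layers-decreasing zero          r = []
layers-decreasing (suc zero)    r = z≤n ∷ []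
layers-decreasing (suc (suc k)) r = length-peel r ∷ layers-decreasing (suc k) (peel r)

layers-mono : ∀ k {s r} → s ⊑ r → Pointwise _≤_ (layers k s) (layers k r)
layers-mono zero    p = []
layers-mono (suc k) p = length-mono p ∷ layers-mono k (peel-mono p)

layers-[] : ∀ k → layers k [] ≡ zeros k
layers-[] zero    = refl
layers-[] (suc k) = cong (0 ∷_) (layers-[] k)

sum-layers : ∀ {r} → Row k r → sum (layers k r) ≡ sumᴸ r
sum-layers {zero}  []              = refl
sum-layers {zero}  (row (s≤s _) () _)
sum-layers {suc k} {r} ρ = trans (cong (length r +_) (sum-layers (peel-row ρ))) (sum-peel ρ)

layers⁻¹-layers : ∀ {r} → Row k r → layers⁻¹ (layers k r) ≡ r
layers⁻¹-layers {zero}  []              = refl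
layers⁻¹-layers {zero}  (row (s≤s _) () _)
layers⁻¹-layers {suc k} {r} ρ =
  trans (cong (unpeel (length r)) (layers⁻¹-layers (peel-row ρ))) (unpeel-peel ρ)

layers⁻¹-row : (v : Vec ℕ k) → Row k (layers⁻¹ v)
layers⁻¹-row []      = []
layers⁻¹-row (a ∷ v) = unpeel-row a (layers⁻¹-row v)

length-layers⁻¹ : {v : Vec ℕ k} → Decreasing v → length (layers⁻¹ v) ≡ hd v
length-layers⁻¹ []                   = refl
length-layers⁻¹ {v = a ∷ v} (p ∷ d) =
  length-unpeel (layers⁻¹ v) (≤-trans (≤-reflexive (length-layers⁻¹ d)) p)

layers-layers⁻¹ : {v : Vec ℕ k} → Decreasing v → layers k (layers⁻¹ v) ≡ v
layers-layers⁻¹ []                   = refl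
layers-layers⁻¹ {v = a ∷ v} (p ∷ d) = cong₂ _∷_ (length-layers⁻¹ (p ∷ d))
  (trans (cong (layers _) (peel-unpeel a (layers⁻¹-row v))) (layers-layers⁻¹ d))

layers⁻¹-mono : {u v : Vec ℕ k} → Pointwise _≤_ u v → layers⁻¹ u ⊑ layers⁻¹ v
layers⁻¹-mono []       = []
layers⁻¹-mono (p ∷ ps) = unpeel-mono p (layers⁻¹-mono ps)

layers⁻¹-zeros : ∀ k → layers⁻¹ (zeros k) ≡ []
layers⁻¹-zeros zero    = refl
layers⁻¹-zeros (suc k) = cong (unpeel 0) (layers⁻¹-zeros k)

first : List (List ℕ) → List ℕ
first []      = []
first (r ∷ _) = r

rest : List (List ℕ) → List (List ℕ)
rest []      = []
rest (_ ∷ π) = π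

data PlanePartition (k : ℕ) : List (List ℕ) → Set where
  []  : PlanePartition k []
  add : ∀ {r π} → 0 < length r → Row k r → first π ⊑ r → PlanePartition k π → PlanePartition k (r ∷ π)

columns : ∀ k N → List (List ℕ) → Vec (Vec ℕ k) N
columns k zero    π = []
columns k (suc N) π = layers k (first π) ∷ columns k N (rest π)

-- An empty row ends the partition: zero columns at the far end of the array are only padding up to
-- N.
addRow : List ℕ → List (List ℕ) → List (List ℕ)
addRow []      π = []
addRow (x ∷ r) π = (x ∷ r) ∷ π

columns⁻¹ : Vec (Vec ℕ k) N → List (List ℕ)
columns⁻¹ []       = []
columns⁻¹ (c ∷ cs) = addRow (layers⁻¹ c) (columns⁻¹ cs)

columns⁻¹-columns : ∀ {π} → PlanePartition k π → length π ≤ N → columns⁻¹ (columns k N π) ≡ π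
columns⁻¹-columns {N = zero}  []                       _        = refl
columns⁻¹-columns {k} {suc N} []                       _        =
  cong (λ r → addRow r (columns⁻¹ (columns k N []))) (layers⁻¹-layers {k} [])
columns⁻¹-columns {N = suc N} (add {x ∷ r} _ ρ _ pp) (s≤s le) =
  cong₂ addRow (layers⁻¹-layers ρ) (columns⁻¹-columns pp le)

total-columns : ∀ {π} → PlanePartition k π → length π ≤ N →
                total (columns k N π) ≡ sumᴸ (List.map sumᴸ π)
total-columns {N = zero}  [] _ = refl
total-columns {k} {suc N} [] _ =
  cong₂ _+_ (trans (cong sum (layers-[] k)) (sum-zeros k)) (total-columns {k} {N} [] z≤n)
total-columns {N = suc N} (add _ ρ _ pp) (s≤s le) = cong₂ _+_ (sum-layers ρ) (total-columns pp le)

columns-valid : ∀ N {π} → PlanePartition k π → Columns (columns k N π)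
columns-valid zero          _  = []
columns-valid {k} (suc N) {π} pp =
  col (layers-decreasing k (first π)) (top≤ N) (columns-valid N (rest-valid pp))
  where
  rest-valid : ∀ {π} → PlanePartition k π → PlanePartition k (rest π)
  rest-valid []             = []
  rest-valid (add _ _ _ pp) = pp
  rest⊑ : ∀ {π} → PlanePartition k π → first (rest π) ⊑ first π
  rest⊑ []            = []
  rest⊑ (add _ _ p _) = p
  zeros-≤ : ∀ {k} (v : Vec ℕ k) → Pointwise _≤_ (zeros k) v
  zeros-≤ []      = []
  zeros-≤ (_ ∷ v) = z≤n ∷ zeros-≤ v
  top≤ : ∀ N → Pointwise _≤_ (top (columns k N (rest π))) (layers k (first π))
  top≤ zero    = zeros-≤ _
  top≤ (suc N) = layers-mono k (rest⊑ pp)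

first-columns⁻¹ : (cs : Vec (Vec ℕ k) N) → first (columns⁻¹ cs) ≡ layers⁻¹ (top cs)
first-columns⁻¹ {k} []   = sym (layers⁻¹-zeros k)
first-columns⁻¹ (c ∷ cs) with layers⁻¹ c
... | []    = refl
... | _ ∷ _ = refl

columns⁻¹-valid : {cs : Vec (Vec ℕ k) N} → Columns cs → PlanePartition k (columns⁻¹ cs)
columns⁻¹-valid [] = []
columns⁻¹-valid {cs = c ∷ cs} (col d p cv)
  with layers⁻¹ c | layers⁻¹-row c | layers⁻¹-mono p
... | []    | _ | _ = []
... | _ ∷ _ | ρ | q = add z<s ρ (subst (_⊑ _) (sym (first-columns⁻¹ cs)) q) (columns⁻¹-valid cv)

columns-columns⁻¹ : {cs : Vec (Vec ℕ k) N} → Columns cs → columns k N (columns⁻¹ cs) ≡ cs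
columns-columns⁻¹ [] = refl
columns-columns⁻¹ {k} {suc N} {c ∷ cs} (col d p cv)
  with layers⁻¹ c | layers-layers⁻¹ d | layers⁻¹-mono p
... | _ ∷ _ | e | _ = cong₂ _∷_ e (columns-columns⁻¹ cv)
-- The columns decrease, so all rows after an empty one are empty too, and the truncation in
-- `addRow` loses nothing.
... | []    | e | q = cong₂ _∷_ e (trans (cong (columns k N) (sym (empty cs q))) (columns-columns⁻¹ cv))
  where
  empty : ∀ {N} (cs : Vec (Vec ℕ k) N) → layers⁻¹ (top cs) ⊑ [] → columns⁻¹ cs ≡ []
  empty []       _ = refl
  empty (c ∷ cs) q with layers⁻¹ c | q
  ... | [] | [] = refl

length≤size : ∀ {π} → PlanePartition k π → length π ≤ sumᴸ (List.map sumᴸ π)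
length≤size [] = z≤n
length≤size (add _ (row p _ _) _ pp) = +-mono-≤ (≤-trans p (m≤m+n _ _)) (length≤size pp)

toRow : ∀ {b r} → All (0 <_) r → All (_≤ b) r → Linked _≥_ r → Row b r
toRow []       []       _            = []
toRow (p ∷ []) (q ∷ []) _            = row p q []
toRow (p ∷ ps@(_ ∷ _)) (q ∷ qs) (y≤x ∷ l) = row p q (toRow ps (bound y≤x l) l)
  where
  bound : ∀ {b x r} → x ≤ b → Linked _≥_ (x ∷ r) → All (_≤ b) (x ∷ r)
  bound le [-]       = le ∷ []
  bound le (y≤x ∷ l) = le ∷ bound (≤-trans y≤x le) l

row-positive : ∀ {b r} → Row b r → All (0 <_) r
row-positive []          = []
row-positive (row p _ ρ) = p ∷ row-positive ρ

row-bounded : ∀ {b r} → Row b r → All (_≤ b) r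
row-bounded []          = []
row-bounded (row _ q ρ) = q ∷ All.map (λ y≤x → ≤-trans y≤x q) (row-bounded ρ)

row-decreasing : ∀ {b r} → Row b r → Linked _≥_ r
row-decreasing []                      = []
row-decreasing (row _ _ [])            = [-]
row-decreasing (row _ _ ρ@(row _ q _)) = q ∷ row-decreasing ρ

toPlanePartition : ∀ {π} → IsPlanePartition k n π → PlanePartition k π
toPlanePartition p = go nonempty positive bounded rows columns′
  where
  open IsPlanePartition p renaming (columns to columns′)
  go : ∀ {π} → All (λ r → 0 < length r) π → All (All (0 <_)) π → All (All (_≤ _)) π →
       All (Linked _≥_) π → Linked (λ r s → Prefix _≤_ s r) π → PlanePartition _ π
  go []       []       []       []       _         = []
  go (a ∷ []) (b ∷ []) (c ∷ []) (d ∷ []) _         = add a (toRow b c d) [] []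
  go (a ∷ as@(_ ∷ _)) (b ∷ bs) (c ∷ cs) (d ∷ ds) (e ∷ es) =
    add a (toRow b c d) e (go as bs cs ds es)

fromPlanePartition : ∀ {π} → PlanePartition k π → sumᴸ (List.map sumᴸ π) ≡ n → IsPlanePartition k n π
fromPlanePartition {k} pp size≡n = record
  { nonempty = map-rows (λ a _ → a) pp
  ; positive = map-rows (λ _ → row-positive) pp
  ; bounded  = map-rows (λ _ → row-bounded) pp
  ; rows     = map-rows (λ _ → row-decreasing) pp
  ; columns  = linked pp
  ; size     = size≡n
  }
  where
  map-rows : ∀ {P : List ℕ → Set} → (∀ {r} → 0 < length r → Row k r → P r) →
             ∀ {π} → PlanePartition k π → All P π
  map-rows f []             = []
  map-rows f (add a ρ _ pp) = f a ρ ∷ map-rows f pp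
  linked : ∀ {π} → PlanePartition k π → Linked (λ r s → Prefix _≤_ s r) π
  linked []                              = []
  linked (add _ _ _ [])                  = [-]
  linked (add _ _ e pp@(add _ _ _ _))    = e ∷ linked pp

-- Generating functions

unique-length : {xs ys : List A} → Unique xs → (∀ {x} → x ∈ xs → x ∈ ys) → length xs ≤ length ys
unique-length []                           _   = z≤n
unique-length {xs = x ∷ xs} (x∉ ∷ u) sub with ∈-∃++ (sub (here refl))
... | ys , zs , refl = begin
  suc (length xs)             ≤⟨ s≤s (unique-length u sub′) ⟩
  suc (length (ys ++ zs))     ≡⟨ cong suc (length-++ ys) ⟩
  suc (length ys + length zs) ≡⟨ +-suc (length ys) (length zs) ⟨
  length ys + suc (length zs) ≡⟨ length-++ ys ⟨
  length (ys ++ x ∷ zs)       ∎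
  where
  open ≤-Reasoning
  sub′ : ∀ {y} → y ∈ xs → y ∈ ys ++ zs
  sub′ {y} y∈ with ∈-++⁻ ys (sub (there y∈))
  ... | inj₁ l           = ∈-++⁺ˡ l
  ... | inj₂ (here refl) = contradiction refl (All.lookup x∉ y∈)
  ... | inj₂ (there r)   = ∈-++⁺ʳ ys r

record Enumeration (size : A → ℕ) (n c : ℕ) : Set where
  field
    list     : List A
    unique   : Unique list
    complete : ∀ {x} → size x ≡ n → x ∈ list
    sound    : ∀ {x} → x ∈ list → size x ≡ n
    count    : length list ≡ c
open Enumeration

-- c is the generating function of A, graded by size.
Counts : (A → ℕ) → Seq → Set
Counts size c = ∀ n → Enumeration size n (c n)

counts-transport : {s : A → ℕ} {t : B → ℕ} {c : Seq} (f : A → B) (g : B → A) →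
  (∀ x → g (f x) ≡ x) → (∀ y → f (g y) ≡ y) → (∀ x → t (f x) ≡ s x) → Counts s c → Counts t c
counts-transport {s = s} {t} f g gf fg ts C n = record
  { list     = List.map f (list (C n))
  ; unique   = map⁺ (λ {x} {y} e → trans (sym (gf x)) (trans (cong g e) (gf y))) (unique (C n))
  ; complete = λ {y} e → subst (_∈ _) (fg y) (∈-map⁺ f (complete (C n)
                 (trans (sym (ts (g y))) (trans (cong t (fg y)) e))))
  ; sound    = λ y∈ → let x , x∈ , e = ∈-map⁻ f y∈ in
                 trans (cong t e) (trans (ts x) (sound (C n) x∈))
  ; count    = trans (length-map f (list (C n))) (count (C n))
  }

-- The recursion `geom-unfold` on the level of sets: a pair either has first component 0, or arises
-- from a pair of size smaller by 1 + v.
counts-ℕ× : ∀ v {s : A → ℕ} {c : Seq} → Counts s c →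
            Counts (λ (m , x) → suc v * m + s x) (geom v c)
counts-ℕ× {A = A} v {s} {c} C = <-rec (λ n → Enumeration size n (geom v c n)) step
  where
  size : ℕ × A → ℕ
  size (m , x) = suc v * m + s x

  bump : ℕ × A → ℕ × A
  bump (m , x) = suc m , x

  size-bump : ∀ y → size (bump y) ≡ suc v + size y
  size-bump (m , x) = rearrange (suc v) m (s x)
    where
    rearrange : ∀ w m r → w * suc m + r ≡ w + (w * m + r)
    rearrange = solve-∀

  size-0 : ∀ x → size (0 , x) ≡ s x
  size-0 x = cong (_+ s x) (*-zeroʳ (suc v))

  base : ∀ n → List (ℕ × A)
  base n = List.map (0 ,_) (list (C n))

  base-unique : ∀ n → Unique (base n)
  base-unique n = map⁺ ,-injectiveʳ (unique (C n))

  base-complete : ∀ {n} x → size (0 , x) ≡ n → (0 , x) ∈ base n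
  base-complete x e = ∈-map⁺ (0 ,_) (complete (C _) (trans (sym (size-0 x)) e))

  base-sound : ∀ {n y} → y ∈ base n → size y ≡ n
  base-sound {n} y∈ with x , x∈ , refl ← ∈-map⁻ (0 ,_) y∈ = trans (size-0 x) (sound (C n) x∈)

  base-count : ∀ n → length (base n) ≡ c n
  base-count n = trans (length-map _ (list (C n))) (count (C n))

  step : ∀ n → (∀ {m} → m < n → Enumeration size m (geom v c m)) → Enumeration size n (geom v c n)
  step n rec with shift-view (suc v) (geom v c) n
  ... | inj₁ (n<w , z) = record
    { list     = base n
    ; unique   = base-unique n
    ; complete = λ { {zero , x} e → base-complete x e
                   ; {suc m , x} e → contradiction
                       (subst (suc v ≤_) (trans (sym (size-bump (m , x))) e) (m≤m+n (suc v) _))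
                       (<⇒≱ n<w) }
    ; sound    = base-sound
    ; count    = trans (base-count n) (sym (trans (geom-unfold v c n)
                   (trans (cong (c n +_) z) (+-identityʳ (c n)))))
    }
  ... | inj₂ (m , refl , z) = record
    { list     = base n ++ List.map bump (list rest′)
    ; unique   = ++⁺ (base-unique n) (map⁺ (λ { refl → refl }) (unique rest′)) disjoint
    ; complete = λ { {zero , x} e → ∈-++⁺ˡ (base-complete x e)
                   ; {suc l , x} e → ∈-++⁺ʳ (base n) (∈-map⁺ bump (complete rest′
                       (+-cancelˡ-≡ (suc v) _ _ (trans (sym (size-bump (l , x))) e)))) }
    ; sound    = sound′
    ; count    = trans (length-++ (base n)) (trans
                   (cong₂ _+_ (base-count n) (trans (length-map bump (list rest′))
                     (trans (count rest′) (sym z))))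
                   (sym (geom-unfold v c n)))
    }
    where
    rest′ = rec (s≤s (m≤n+m m v))
    disjoint : ∀ {y} → y ∈ base n × y ∈ List.map bump (list rest′) → _
    disjoint (p , q) with ∈-map⁻ (0 ,_) p | ∈-map⁻ bump q
    ... | _ , _ , refl | _ , _ , ()
    sound′ : ∀ {y} → y ∈ base n ++ List.map bump (list rest′) → size y ≡ n
    sound′ y∈ with ∈-++⁻ (base n) y∈
    ... | inj₁ p = base-sound p
    ... | inj₂ q with y , q′ , refl ← ∈-map⁻ bump q =
      trans (size-bump y) (cong (suc v +_) (sound rest′ q′))

counts-row : ∀ a N {s : A → ℕ} {c : Seq} → Counts s c →
             Counts {Vec ℕ N × A} (λ (ms , x) → rowWeight a ms + s x) (geomRow a N c)
counts-row a zero    C = counts-transport ([] ,_) proj₂ (λ _ → refl) (λ { ([] , _) → refl }) (λ _ → refl) C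
counts-row a (suc N) {s} C = counts-transport
  (λ (m , ms , x) → m ∷ ms , x) (λ y → Vec.head (proj₁ y) , Vec.tail (proj₁ y) , proj₂ y)
  (λ _ → refl) (λ { (_ ∷ _ , _) → refl })
  (λ (m , ms , x) → +-assoc (suc a * m) (rowWeight (suc a) ms) (s x))
  (counts-ℕ× a (counts-row (suc a) N C))

counts-matrices : ∀ N k a → Counts {Vec (Vec ℕ N) k} (weight a) (geomRows N a k one)
counts-matrices N zero a zero = record
  { list = [] ∷ [] ; unique = [] ∷ [] ; complete = λ { {[]} _ → here refl }
  ; sound = λ { (here refl) → refl } ; count = refl }
counts-matrices N zero a (suc n) = record
  { list = [] ; unique = [] ; complete = λ { {[]} () } ; sound = λ () ; count = refl }
counts-matrices N (suc k) a = counts-transport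
  (λ (ms , M) → ms ∷ M) (λ M → Vec.head M , Vec.tail M) (λ _ → refl) (λ { (_ ∷ _) → refl }) (λ _ → refl)
  (counts-row a N (counts-matrices N k (suc a)))

-- The bijection between matrices and plane partitions

fromMatrix : Vec (Vec ℕ N) k → List (List ℕ)
fromMatrix M = columns⁻¹ (cut⁻¹ (rsk M))

toMatrix : ∀ k N → List (List ℕ) → Vec (Vec ℕ N) k
toMatrix k N π = rsk⁻¹ (cut (columns k N π))

toMatrix-fromMatrix : (M : Vec (Vec ℕ N) k) → toMatrix k N (fromMatrix M) ≡ M
toMatrix-fromMatrix M = begin
  rsk⁻¹ (cut (columns _ _ (columns⁻¹ (cut⁻¹ (rsk M)))))
    ≡⟨ cong (rsk⁻¹ ∘ cut) (columns-columns⁻¹ (cut⁻¹-columns (rsk M) (rsk-interlacing M))) ⟩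
  rsk⁻¹ (cut (cut⁻¹ (rsk M)))
    ≡⟨ cong rsk⁻¹ (cut-cut⁻¹ (rsk M) (rsk-interlacing M)) ⟩
  rsk⁻¹ (rsk M)
    ≡⟨ rsk⁻¹-rsk M ⟩
  M ∎
  where open ≡-Reasoning

fromMatrix-toMatrix : ∀ {π} → PlanePartition k π → length π ≤ N → fromMatrix (toMatrix k N π) ≡ π
fromMatrix-toMatrix {k} {N} {π} pp le = begin
  columns⁻¹ (cut⁻¹ (rsk (rsk⁻¹ (cut (columns k N π)))))
    ≡⟨ cong (columns⁻¹ ∘ cut⁻¹) (rsk-rsk⁻¹ _ (cut-interlacing (columns-valid N pp))) ⟩
  columns⁻¹ (cut⁻¹ (cut (columns k N π)))
    ≡⟨ cong columns⁻¹ (cut⁻¹-cut (columns k N π)) ⟩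
  columns⁻¹ (columns k N π)
    ≡⟨ columns⁻¹-columns pp le ⟩
  π ∎
  where open ≡-Reasoning

weight-toMatrix : ∀ {π} → PlanePartition k π → length π ≤ N →
                  weight 0 (toMatrix k N π) ≡ sumᴸ (List.map sumᴸ π)
weight-toMatrix {k} {N} {π} pp le = begin
  weight 0 (toMatrix k N π)                      ≡⟨ volume-rsk (toMatrix k N π) ⟨
  volume (rsk (rsk⁻¹ (cut (columns k N π))))     ≡⟨ cong volume (rsk-rsk⁻¹ _ (cut-interlacing (columns-valid N pp))) ⟩
  volume (cut (columns k N π))                   ≡⟨ volume-cut (columns k N π) ⟩
  total (columns k N π)                          ≡⟨ total-columns pp le ⟩
  sumᴸ (List.map sumᴸ π)                         ∎
  where open ≡-Reasoning

fromMatrix-valid : (M : Vec (Vec ℕ N) k) → PlanePartition k (fromMatrix M)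
fromMatrix-valid M = columns⁻¹-valid (cut⁻¹-columns (rsk M) (rsk-interlacing M))

length-fromMatrix : (M : Vec (Vec ℕ N) k) → length (fromMatrix M) ≤ N
length-fromMatrix M = length-columns⁻¹ (cut⁻¹ (rsk M))
  where
  length-columns⁻¹ : ∀ {N} (cs : Vec (Vec ℕ k) N) → length (columns⁻¹ cs) ≤ N
  length-columns⁻¹ []       = z≤n
  length-columns⁻¹ (c ∷ cs) with layers⁻¹ c
  ... | []    = z≤n
  ... | _ ∷ _ = s≤s (length-columns⁻¹ cs)

size-fromMatrix : (M : Vec (Vec ℕ N) k) → sumᴸ (List.map sumᴸ (fromMatrix M)) ≡ weight 0 M
size-fromMatrix M = trans
  (sym (weight-toMatrix (fromMatrix-valid M) (length-fromMatrix M)))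
  (cong (weight 0) (toMatrix-fromMatrix M))

-- A plane partition of n has at most n ≤ N rows and so fits into the array. The two enumerations,
-- each free of repetitions, then contain each other and have equal lengths.
pl-series : ∀ N k n → n ≤ N → pl k n ≡ geomRows N 0 k one n
pl-series N k n n≤N = trans
  (≤-antisym (unique-length (planePartitions-unique k n) left)
             (unique-length unique′ right))
  (trans (length-map fromMatrix (list matrices)) (count matrices))
  where
  matrices = counts-matrices N k 0 n
  unique′ : Unique (List.map fromMatrix (list matrices))
  unique′ = map⁺ (λ {M} {M′} e → trans (sym (toMatrix-fromMatrix M))
              (trans (cong (toMatrix k N) e) (toMatrix-fromMatrix M′))) (unique matrices)
  left : ∀ {π} → π ∈ planePartitions k n → π ∈ List.map fromMatrix (list matrices)
  left {π} π∈ = subst (_∈ _) (fromMatrix-toMatrix pp le)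
    (∈-map⁺ fromMatrix (complete matrices (trans (weight-toMatrix pp le) size≡n)))
    where
    valid = Equivalence.to (∈-planePartitions k n) π∈
    size≡n = IsPlanePartition.size valid
    pp : PlanePartition k π
    pp = toPlanePartition valid
    le : length π ≤ N
    le = ≤-trans (length≤size pp) (≤-trans (≤-reflexive size≡n) n≤N)
  right : ∀ {π} → π ∈ List.map fromMatrix (list matrices) → π ∈ planePartitions k n
  right π∈ with M , M∈ , refl ← ∈-map⁻ fromMatrix π∈ =
    Equivalence.from (∈-planePartitions k n)
      (fromPlanePartition (fromMatrix-valid M) (trans (size-fromMatrix M) (sound matrices M∈)))

-- The congruences modulo 1 + q that hold for the coefficients of numerator · g,
-- for every series g in x^(1+q).
Congruent : ℕ → Seq → Set
Congruent q f = ∀ cs r t → r ≤ q →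
  T (Coefficients.good q r (Coefficients.timesNumerator q cs)) →
  act 1 cs f (r + t * suc q) % suc q ≡ 0

pl-congruent : ∀ q → Coefficients.Frobenius q → Congruent q (pl (suc q))
pl-congruent q frobenius cs r t r≤q ok = trans
  (at (congr (act-linear 1 cs) (mk λ {i} i≤ → cong (_% suc q) (pl-series i₀ (suc q) i i≤))) ≤-refl)
  (geomRows-congruence frobenius cs r t r≤q ≤-refl ok)
  where
  -- The cut-off is the very index at which the coefficient is read, so both bounds required below
  -- are `≤-refl`.
  i₀ = r + t * suc q
  open Modular q i₀
  open _≈_
  open Linear

-- The individual congruences

complement : ∀ q x y → (q * y + x) % suc q ≡ 0 → x % suc q ≡ y % suc q
complement q x y e = begin
  x % suc q                     ≡⟨ [m+kn]%n≡m%n x y (suc q) ⟨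
  (x + y * suc q) % suc q       ≡⟨ cong (_% suc q) (rearrange q x y) ⟩
  (y + (q * y + x)) % suc q     ≡⟨ %-distribˡ-+ y _ (suc q) ⟩
  (y % suc q + (q * y + x) % suc q) % suc q
                                ≡⟨ cong (λ z → (y % suc q + z) % suc q) e ⟩
  (y % suc q + 0) % suc q       ≡⟨ cong (_% suc q) (+-identityʳ (y % suc q)) ⟩
  y % suc q % suc q             ≡⟨ m%n%n≡m%n y (suc q) ⟩
  y % suc q                     ∎
  where
  open ≡-Reasoning
  rearrange : ∀ q x y → x + y * suc q ≡ y + (q * y + x)
  rearrange = solve-∀

-- Of `pl` only the property `Congruent` enters, so the argument is carried out for an arbitrary
-- series.
module Consequences (f : Seq) where

  residue : ∀ k n r → f (k * n + r) ≡ f (r + n * k)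
  residue k n r = cong f (trans (+-comm (k * n) r) (cong (r +_) (*-comm k n)))

  act-last : ∀ c n → act 1 (c ∷ []) f n ≡ c * f n
  act-last c zero    = +-identityʳ _
  act-last c (suc n) = +-identityʳ _

  adjacent : ∀ q n → act 1 (q ∷ 1 ∷ []) f (suc n) ≡ q * f (suc n) + f n
  adjacent q n = cong (q * f (suc n) +_) (trans (act-last 1 n) (*-identityˡ (f n)))

  alternate : ∀ q n → act 1 (q ∷ 0 ∷ 1 ∷ []) f (2 + n) ≡ q * f (2 + n) + f n
  alternate q n = cong (q * f (2 + n) +_) (trans (act-last 1 n) (*-identityˡ (f n)))

  modulo-2 : Congruent 1 f → ∀ n → f (2 * n + 1) % 2 ≡ f (2 * n) % 2
  modulo-2 F n = begin
    f (2 * n + 1) % 2  ≡⟨ cong (_% 2) (residue 2 n 1) ⟩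
    f (1 + n * 2) % 2  ≡⟨ complement 1 (f (n * 2)) (f (1 + n * 2)) (trans (cong (_% 2) (sym (adjacent 1 (n * 2))))
                            -- The numerator is 1 - x, and (1 + x)(1 - x) = 1 - x^2 has no odd
                            -- terms. The final `_` is the evaluated check `good`.
                            (F (1 ∷ 1 ∷ []) 1 n ≤-refl _)) ⟨
    f (n * 2) % 2      ≡⟨ cong (λ i → f i % 2) (*-comm 2 n) ⟨
    f (2 * n) % 2      ∎
    where open ≡-Reasoning

  modulo-3-zero : Congruent 2 f → ∀ n → f (3 * n + 2) % 3 ≡ 0
  modulo-3-zero F n = trans (cong (_% 3) (trans (residue 3 n 2)
      (sym (trans (act-last 1 (2 + n * 3)) (*-identityˡ _)))))
    -- The numerator (1 - x)^2 (1 - x^2) = 1 - 2x + 2x^3 - x^4 has no term in x^2 and none in x^5.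
    (F (1 ∷ []) 2 n ≤-refl _)

  modulo-3 : Congruent 2 f → ∀ n → f (3 * n + 1) % 3 ≡ f (3 * n) % 3
  modulo-3 F n = begin
    f (3 * n + 1) % 3  ≡⟨ cong (_% 3) (residue 3 n 1) ⟩
    f (1 + n * 3) % 3  ≡⟨ complement 2 (f (n * 3)) (f (1 + n * 3)) (trans (cong (_% 3) (sym (adjacent 2 (n * 3))))
                            (F (2 ∷ 1 ∷ []) 1 n (s≤s z≤n) _)) ⟨
    f (n * 3) % 3      ≡⟨ cong (λ i → f i % 3) (*-comm 3 n) ⟨
    f (3 * n) % 3      ∎
    where open ≡-Reasoning

  modulo-5 : Congruent 4 f → ∀ n r → 2 + r ≤ 4 →
    T (Coefficients.good 4 (2 + r) (Coefficients.timesNumerator 4 (4 ∷ 0 ∷ 1 ∷ []))) →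
    f (5 * n + r) % 5 ≡ f (5 * n + (2 + r)) % 5
  modulo-5 F n r r≤4 ok = begin
    f (5 * n + r) % 5        ≡⟨ cong (_% 5) (residue 5 n r) ⟩
    f (r + n * 5) % 5        ≡⟨ complement 4 (f (r + n * 5)) (f (2 + r + n * 5)) (trans (cong (_% 5) (sym (alternate 4 (r + n * 5))))
                                  -- The list stands for x^2 - 1 modulo 5, whose action at index 2 +
                                  -- r + 5n is the difference of the two values.
                                  (F (4 ∷ 0 ∷ 1 ∷ []) (2 + r) n r≤4 ok)) ⟩
    f (2 + r + n * 5) % 5    ≡⟨ cong (_% 5) (residue 5 n (2 + r)) ⟨
    f (5 * n + (2 + r)) % 5  ∎
    where open ≡-Reasoning

  modulo-7 : Congruent 6 f → ∀ n →
    (f (7 * n + 2) + f (7 * n + 3)) % 7 ≡ (f (7 * n + 4) + f (7 * n + 5)) % 7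
  modulo-7 F n = begin
    (f (7 * n + 2) + f (7 * n + 3)) % 7
      ≡⟨ cong (_% 7) (cong₂ _+_ (residue 7 n 2) (residue 7 n 3)) ⟩
    (g 2 + g 3) % 7
      ≡⟨ complement 6 (g 2 + g 3) (g 4 + g 5) (trans (cong (_% 7) (sym expand))
           -- The list stands for x^3 + x^2 - x - 1 modulo 7; read at index 5 + 7n it subtracts the
           -- values at residues 5 and 4 from those at 2 and 3.
           (F (6 ∷ 6 ∷ 1 ∷ 1 ∷ []) 5 n (m≤n+m 5 1) _)) ⟩
    (g 4 + g 5) % 7
      ≡⟨ cong (_% 7) (cong₂ _+_ (residue 7 n 4) (residue 7 n 5)) ⟨
    (f (7 * n + 4) + f (7 * n + 5)) % 7 ∎
    where
    open ≡-Reasoning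
    g : Seq
    g r = f (r + n * 7)
    rearrange : ∀ a b c d → 6 * d + (6 * c + (1 * b + 1 * a)) ≡ 6 * (c + d) + (a + b)
    rearrange = solve-∀
    expand : act 1 (6 ∷ 6 ∷ 1 ∷ 1 ∷ []) f (5 + n * 7) ≡ 6 * (g 4 + g 5) + (g 2 + g 3)
    expand = trans
      (cong (λ x → 6 * g 5 + (6 * g 4 + (1 * g 3 + x))) (act-last 1 (2 + n * 7)))
      (rearrange (g 2) (g 3) (g 4) (g 5))

theorem2 : ∀ (n : ℕ) →
    (pl 2 (2 * n + 1) % 2 ≡ pl 2 (2 * n) % 2)
    × (pl 3 (3 * n + 2) % 3 ≡ 0 % 3)
    × (pl 3 (3 * n + 1) % 3 ≡ pl 3 (3 * n) % 3)
    × (pl 5 (5 * n + 2) % 5 ≡ pl 5 (5 * n + 4) % 5)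
    × (pl 5 (5 * n + 1) % 5 ≡ pl 5 (5 * n + 3) % 5)
    × ((pl 7 (7 * n + 2) + pl 7 (7 * n + 3)) % 7 ≡ (pl 7 (7 * n + 4) + pl 7 (7 * n + 5)) % 7)
theorem2 n =
    -- Each `refl` evaluates (1 - x)^p and compares its coefficients with those of 1 - x^p modulo p.
    modulo-2 (pl 2) (pl-congruent 1 refl) n
  , modulo-3-zero (pl 3) (pl-congruent 2 refl) n
  , modulo-3 (pl 3) (pl-congruent 2 refl) n
  , modulo-5 (pl 5) (pl-congruent 4 refl) n 2 ≤-refl _
  , modulo-5 (pl 5) (pl-congruent 4 refl) n 1 (n≤1+n 3) _
  , modulo-7 (pl 7) (pl-congruent 6 refl) n
  where open Consequences
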